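{- (1) For every non-identity element $x$ of a $^\star$-involutive idempotent residuated chain $\mathbf A$, the set $\langle x\rangle$ is a layer-convex subset of the enhanced monoidal preorder of $\mathbf A$. (2) A non-trivial idempotent residuated chain is one-generated and $^\star$-involutive if and only if it is crownian.
   Context: A residuated lattice is an algebra $(A,\wedge,\vee,\cdot,\backslash,/,1)$ such that $(A,\wedge,\vee)$ is a lattice, $(A,\cdot,1)$ is a monoid, and $y\le x\backslash z \iff x\cdot y\le z\iff x\le z/y$. An idempotent residuated chain is a residuated lattice whose order is total and which satisfies $x\cdot x=x$. Define $x^r:=x\backslash 1$, $x^\ell:=1/x$, $x^\star:=x^\ell\wedge x^r$. It is $^\star$-involutive if $x^{\star\star}=x$ for all $x$. It is one-generated if it is generated as a residuated lattice by a single element. For an element $x$, $\langle x\rangle$ denotes the smallest set containing $x$ and closed under $^\ell$ and $^r$ (so the subalgebra generated by $x$ is $\langle x\rangle\cup\{1\}$). Monoidal preorder: $x\sqsubseteq y$ iff $xy=x$; this is a preorder on any idempotent residuated chain $\mathbf A$. Write $x\sqsubset y$ if $x\sqsubseteq y$ and $y\not\sqsubseteq x$. Put $A^+=\{x:x\ge 1\}$, $A^-=\{x:x\le 1\}$. The enhanced monoidal preorder of $\mathbf A$ is $(A,\sqsubseteq,A^+,A^-,1,{}^\star)$. Two elements are in the same layer if they have the same sets of strict $\sqsubset$-upper bounds and the same sets of strict $\sqsubset$-lower bounds; $\overline x$ denotes the layer of $x$, and layers are totally ordered by: $\overline x\le\overline y$ iff $x,y$ are in the same layer or $x\sqsubseteq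 y$. A subset $Q$ is layer-convex if $q_1,q_2\in Q$ and $\overline{q_1}\le\overline p\le\overline{q_2}$ imply $p\in Q$. Enhanced preorders: preordered sets $P$ with two distinguished subsets $P^+,P^-$. Let $\mathbf 1_L$ be a singleton with $P^+=P$, $P^-=\emptyset$; $\mathbf 1_R$ a singleton with $P^+=\emptyset$, $P^-=P$; $\mathbf 2_L=\{a,b\}$ with $P^+=\{a\}$, $P^-=\{b\}$, $a\sqsubseteq b$ and $b\sqsubseteq a$; $\mathbf 2_R=\{a,b\}$ with $P^+=\{a\}$, $P^-=\{b\}$ and $a,b$ incomparable. The ordinal sum $\bigoplus_{i\in I}\mathbf P_i$ over a chain $I$ is the disjoint union with $x\sqsubseteq y$ iff ($x\in P_i$, $y\in P_j$, $i<j$) or ($x,y\in P_i$ and $x\sqsubseteq_{P_i}y$), with positive and negative parts the unions of those of the summands ($\mathbf P\oplus\mathbf Q$: $\mathbf P$ below $\mathbf Q$). A vertical crown is one of the following, where the topmost summand $\mathbf 1_L$ is the identity element $1$, which is also added to $P^-$ (so $P^+\cap P^-=\{1\}$), $L\subseteq I$ is arbitrary, and $\mathbf P_i=\mathbf 2_L$ for $i\in L$, $\mathbf P_i=\mathbf 2_R$ for $i\in I\setminus L$: (a) $(\bigoplus_{i\in I}\mathbf P_i)\oplus\mathbf 1_L$ with $I=\mathbb Z$; (b) $\mathbf 1_R\oplus(\bigoplus_{i\in I}\mathbf P_i)\oplus\mathbf 1_L$ with $I=\mathbb N$; (c) $(\bigoplus_{i\in I}\mathbf P_i)\oplus\mathbf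 1_L\oplus\mathbf 1_L$ with $I=\mathbb N^\partial$ (the order dual of $\mathbb N$); (d) $\mathbf 1_R\oplus(\bigoplus_{i\in I}\mathbf P_i)\oplus\mathbf 1_L\oplus\mathbf 1_L$ with $I=\{1,\dots,n\}$, $n\ge 0$. An idempotent residuated chain $\mathbf A$ is crownian if $(A,\sqsubseteq,A^+,A^-)$ is isomorphic to a vertical crown (with $1$ corresponding to the identity element). -}

module Defs where

open import Algebra.Core using (Op₁; Op₂)
open import Algebra.Definitions using (Idempotent)
open import Algebra.Structures using (IsMonoid)
open import Data.Bool.Base using (Bool; if_then_else_)
open import Data.Fin.Base using (Fin)
import Data.Fin.Properties as Fin
open import Data.Integer.Base using (ℤ)
import Data.Integer.Properties as ℤ
open import Data.Nat.Base using (ℕ)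
import Data.Nat.Properties as ℕ
open import Data.Product.Base using (Σ; ∃; ∃₂; _×_; _,_)
open import Data.Sum.Base using (_⊎_; inj₁; inj₂)
open import Data.Sum.Relation.Binary.LeftOrder using (_⊎-<_; ⊎-<-isPreorder)
open import Data.Sum.Relation.Binary.Pointwise using (Pointwise; inj₁; inj₂)
open import Data.Unit.Base using (⊤; tt)
open import Function.Bundles using (_⇔_)
open import Level using (Level; _⊔_; 0ℓ) renaming (suc to lsuc)
open import Relation.Binary.Core using (Rel)
open import Relation.Binary.Definitions using (Total; _Respects_)
open import Relation.Binary.Structures
  using (IsPreorder; IsStrictTotalOrder)
open import Relation.Binary.Lattice.Structures using (IsLattice)
open import Relation.Binary.Morphism.Structures using (IsOrderIsomorphism)
open import Relation.Binary.PropositionalEquality.Core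
  using (_≡_) renaming (sym to ≡-sym; trans to ≡-trans)
import Relation.Binary.PropositionalEquality.Properties as ≡
import Relation.Binary.Construct.Flip.EqAndOrd as Flip
import Relation.Binary.Reasoning.Setoid as ≈-Reasoning
open import Relation.Nullary.Negation.Core using (¬_)
open import Relation.Unary using (Pred; _∈_; ∅; U)

private
  variable
    c ℓ₁ ℓ₂ ℓ₃ c′ ℓ₁′ ℓ₂′ ℓ₃′ : Level

-- As for the library's Heyting algebras, the lattice is given
-- order-theoretically and equality is an arbitrary equivalence _≈_.

record ResiduatedLattice c ℓ₁ ℓ₂ : Set (lsuc (c ⊔ ℓ₁ ⊔ ℓ₂)) where
  infix  4 _≈_ _≤_
  infixr 6 _∨_
  infixr 7 _∧_
  infixl 8 _∙_
  infixr 8 _\\_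
  infixl 8 _//_
  field
    Carrier   : Set c
    _≈_       : Rel Carrier ℓ₁
    _≤_       : Rel Carrier ℓ₂
    _∧_       : Op₂ Carrier
    _∨_       : Op₂ Carrier
    _∙_       : Op₂ Carrier
    _\\_      : Op₂ Carrier
    _//_      : Op₂ Carrier
    1#        : Carrier
    isLattice : IsLattice _≈_ _≤_ _∨_ _∧_
    isMonoid  : IsMonoid _≈_ _∙_ 1#
    \\-residual : ∀ x y z → (y ≤ x \\ z) ⇔ (x ∙ y ≤ z)
    //-residual : ∀ x y z → (x ≤ z // y) ⇔ (x ∙ y ≤ z)

  open IsLattice isLattice public
  open IsMonoid isMonoid public
    using (setoid; assoc; ∙-cong; ∙-congˡ; ∙-congʳ; identity; identityˡ; identityʳ)
    renaming (refl to ≈-refl; sym to ≈-sym; trans to ≈-trans)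

  infix 9 _ʳ _ˡ _⋆

  _ʳ : Op₁ Carrier
  x ʳ = x \\ 1#

  _ˡ : Op₁ Carrier
  x ˡ = 1# // x

  _⋆ : Op₁ Carrier
  x ⋆ = x ˡ ∧ x ʳ

  ⋆-Involutive : Set (c ⊔ ℓ₁)
  ⋆-Involutive = ∀ x → (x ⋆) ⋆ ≈ x

  NonTrivial : Set (c ⊔ ℓ₁)
  NonTrivial = ∃₂ λ x y → ¬ (x ≈ y)

  -- Here and in ⟨_⟩, resp makes the generated set a subset of the setoid.
  data Sg (g : Carrier) : Pred Carrier (c ⊔ ℓ₁) where
    gen  : g ∈ Sg g
    unit : 1# ∈ Sg g
    meet : ∀ {x y} → x ∈ Sg g → y ∈ Sg g → x ∧ y ∈ Sg g
    join : ∀ {x y} → x ∈ Sg g → y ∈ Sg g → x ∨ y ∈ Sg g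
    mult : ∀ {x y} → x ∈ Sg g → y ∈ Sg g → x ∙ y ∈ Sg g
    ldiv : ∀ {x y} → x ∈ Sg g → y ∈ Sg g → x \\ y ∈ Sg g
    rdiv : ∀ {x y} → x ∈ Sg g → y ∈ Sg g → x // y ∈ Sg g
    resp : ∀ {x y} → x ≈ y → x ∈ Sg g → y ∈ Sg g

  OneGenerated : Set (c ⊔ ℓ₁)
  OneGenerated = ∃ λ g → ∀ x → x ∈ Sg g

  data ⟨_⟩ (x : Carrier) : Pred Carrier (c ⊔ ℓ₁) where
    base  : x ∈ ⟨ x ⟩
    left  : ∀ {y} → y ∈ ⟨ x ⟩ → y ˡ ∈ ⟨ x ⟩
    right : ∀ {y} → y ∈ ⟨ x ⟩ → y ʳ ∈ ⟨ x ⟩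
    resp  : ∀ {y z} → y ≈ z → y ∈ ⟨ x ⟩ → z ∈ ⟨ x ⟩

record IdempotentResiduatedChain c ℓ₁ ℓ₂ : Set (lsuc (c ⊔ ℓ₁ ⊔ ℓ₂)) where
  field
    residuatedLattice : ResiduatedLattice c ℓ₁ ℓ₂

  open ResiduatedLattice residuatedLattice public

  field
    total : Total _≤_
    idem  : Idempotent _≈_ _∙_

record EnhancedPreorder c ℓ₁ ℓ₂ ℓ₃ : Set (lsuc (c ⊔ ℓ₁ ⊔ ℓ₂ ⊔ ℓ₃)) where
  infix 4 _≈_ _⊑_
  field
    Carrier    : Set c
    _≈_        : Rel Carrier ℓ₁
    _⊑_        : Rel Carrier ℓ₂
    isPreorder : IsPreorder _≈_ _⊑_
    P⁺         : Pred Carrier ℓ₃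
    P⁻         : Pred Carrier ℓ₃
    P⁺-resp    : P⁺ Respects _≈_
    P⁻-resp    : P⁻ Respects _≈_

  open IsPreorder isPreorder public

record Isomorphism (P : EnhancedPreorder c ℓ₁ ℓ₂ ℓ₃)
                   (Q : EnhancedPreorder c′ ℓ₁′ ℓ₂′ ℓ₃′) :
                   Set (c ⊔ ℓ₁ ⊔ ℓ₂ ⊔ ℓ₃ ⊔ c′ ⊔ ℓ₁′ ⊔ ℓ₂′ ⊔ ℓ₃′) where
  private
    module P = EnhancedPreorder P
    module Q = EnhancedPreorder Q
  field
    to                 : P.Carrier → Q.Carrier
    isOrderIsomorphism : IsOrderIsomorphism P._≈_ Q._≈_ P._⊑_ Q._⊑_ to
    positive           : ∀ x → x ∈ P.P⁺ ⇔ to x ∈ Q.P⁺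
    negative           : ∀ x → x ∈ P.P⁻ ⇔ to x ∈ Q.P⁻

module Layers (P : EnhancedPreorder c ℓ₁ ℓ₂ ℓ₃) where
  open EnhancedPreorder P

  infix 4 _⊏_ _≤ᴸ_

  _⊏_ : Rel Carrier ℓ₂
  x ⊏ y = x ⊑ y × ¬ (y ⊑ x)

  SameLayer : Rel Carrier (c ⊔ ℓ₂)
  SameLayer x y = (∀ z → x ⊏ z ⇔ y ⊏ z) × (∀ z → z ⊏ x ⇔ z ⊏ y)

  -- The order of layers, expressed on representatives.
  _≤ᴸ_ : Rel Carrier (c ⊔ ℓ₂)
  x ≤ᴸ y = SameLayer x y ⊎ x ⊑ y

  LayerConvex : ∀ {ℓ} → Pred Carrier ℓ → Set (c ⊔ ℓ₂ ⊔ ℓ)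
  LayerConvex Q = ∀ {q₁ q₂ p} → q₁ ∈ Q → q₂ ∈ Q → q₁ ≤ᴸ p → p ≤ᴸ q₂ → p ∈ Q

-- The remaining structure of the enhanced monoidal preorder, 1# and _⋆,
-- is not recorded here: layer-convexity depends on _⊑_ only, and the
-- isomorphisms considered below are those of this reduct that match up
-- the identity elements.

module _ (A : IdempotentResiduatedChain c ℓ₁ ℓ₂) where
  open IdempotentResiduatedChain A

  enhancedMonoidalPreorder : EnhancedPreorder c ℓ₁ ℓ₁ ℓ₂
  enhancedMonoidalPreorder = record
    { Carrier    = Carrier
    ; _≈_        = _≈_
    ; _⊑_        = λ x y → x ∙ y ≈ x
    ; isPreorder = record
      { isEquivalence = IsMonoid.isEquivalence isMonoid
      ; reflexive     = λ {x} {y} x≈y → ≈-trans (∙-congˡ (≈-sym x≈y)) (idem x)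
      ; trans         = ⊑-trans
      }
    ; P⁺         = λ x → 1# ≤ x
    ; P⁻         = λ x → x ≤ 1#
    ; P⁺-resp    = ≤-respʳ-≈
    ; P⁻-resp    = ≤-respˡ-≈
    }
    where
    ⊑-trans : ∀ {x y z} → x ∙ y ≈ x → y ∙ z ≈ y → x ∙ z ≈ x
    ⊑-trans {x} {y} {z} x⊑y y⊑z = begin
      x ∙ z        ≈⟨ ∙-congʳ x⊑y ⟨
      (x ∙ y) ∙ z  ≈⟨ assoc x y z ⟩
      x ∙ (y ∙ z)  ≈⟨ ∙-congˡ y⊑z ⟩
      x ∙ y        ≈⟨ x⊑y ⟩
      x            ∎
      where open ≈-Reasoning setoid

EP : Set₁
EP = EnhancedPreorder 0ℓ 0ℓ 0ℓ 0ℓ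

𝟏ᴸ : EP
𝟏ᴸ = record
  { Carrier    = ⊤
  ; _≈_        = _≡_
  ; _⊑_        = _≡_
  ; isPreorder = ≡.isPreorder
  ; P⁺         = U
  ; P⁻         = ∅
  ; P⁺-resp    = λ _ p → p
  ; P⁻-resp    = λ _ p → p
  }

𝟏ᴿ : EP
𝟏ᴿ = record
  { Carrier    = ⊤
  ; _≈_        = _≡_
  ; _⊑_        = _≡_
  ; isPreorder = ≡.isPreorder
  ; P⁺         = ∅
  ; P⁻         = U
  ; P⁺-resp    = λ _ p → p
  ; P⁻-resp    = λ _ p → p
  }

data Two : Set where
  a b : Two

𝟐ᴸ : EP
𝟐ᴸ = record
  { Carrier    = Two
  ; _≈_        = _≡_
  ; _⊑_        = λ _ _ → ⊤
  ; isPreorder = record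
    { isEquivalence = ≡.isEquivalence
    ; reflexive     = λ _ → tt
    ; trans         = λ _ _ → tt
    }
  ; P⁺         = _≡ a
  ; P⁻         = _≡ b
  ; P⁺-resp    = λ x≡y x≡a → ≡-trans (≡-sym x≡y) x≡a
  ; P⁻-resp    = λ x≡y x≡b → ≡-trans (≡-sym x≡y) x≡b
  }

𝟐ᴿ : EP
𝟐ᴿ = record
  { Carrier    = Two
  ; _≈_        = _≡_
  ; _⊑_        = _≡_
  ; isPreorder = ≡.isPreorder
  ; P⁺         = _≡ a
  ; P⁻         = _≡ b
  ; P⁺-resp    = λ x≡y x≡a → ≡-trans (≡-sym x≡y) x≡a
  ; P⁻-resp    = λ x≡y x≡b → ≡-trans (≡-sym x≡y) x≡b
  }

infixr 5 _⊕_

_⊕_ : EP → EP → EP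
P ⊕ Q = record
  { Carrier    = P.Carrier ⊎ Q.Carrier
  ; _≈_        = Pointwise P._≈_ Q._≈_
  ; _⊑_        = P._⊑_ ⊎-< Q._⊑_
  ; isPreorder = ⊎-<-isPreorder P.isPreorder Q.isPreorder
  ; P⁺         = pos
  ; P⁻         = neg
  ; P⁺-resp    = pos-resp
  ; P⁻-resp    = neg-resp
  }
  where
  module P = EnhancedPreorder P
  module Q = EnhancedPreorder Q

  pos neg : Pred (P.Carrier ⊎ Q.Carrier) 0ℓ
  pos (inj₁ x) = P.P⁺ x
  pos (inj₂ y) = Q.P⁺ y
  neg (inj₁ x) = P.P⁻ x
  neg (inj₂ y) = Q.P⁻ y

  pos-resp : pos Respects Pointwise P._≈_ Q._≈_
  pos-resp (inj₁ x≈y) = P.P⁺-resp x≈y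
  pos-resp (inj₂ x≈y) = Q.P⁺-resp x≈y

  neg-resp : neg Respects Pointwise P._≈_ Q._≈_
  neg-resp (inj₁ x≈y) = P.P⁻-resp x≈y
  neg-resp (inj₂ x≈y) = Q.P⁻-resp x≈y

module _ {I : Set} {_<_ : Rel I 0ℓ} (chain : IsStrictTotalOrder _≡_ _<_)
         (P : I → EP) where
  private
    module C = IsStrictTotalOrder chain
    module P i = EnhancedPreorder (P i)

  data ⨁-≈ : Rel (Σ I P.Carrier) 0ℓ where
    within : ∀ {i x y} → P._≈_ i x y → ⨁-≈ (i , x) (i , y)

  data ⨁-⊑ : Rel (Σ I P.Carrier) 0ℓ where
    between : ∀ {i j x y} → i < j → ⨁-⊑ (i , x) (j , y)
    within  : ∀ {i x y} → P._⊑_ i x y → ⨁-⊑ (i , x) (i , y)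

  ⨁ : EP
  ⨁ = record
    { Carrier    = Σ I P.Carrier
    ; _≈_        = ⨁-≈
    ; _⊑_        = ⨁-⊑
    ; isPreorder = record
      { isEquivalence = record
        { refl  = λ {(i , _)} → within (P.Eq.refl i)
        ; sym   = λ { (within {i} x≈y) → within (P.Eq.sym i x≈y) }
        ; trans = λ { (within {i} x≈y) (within y≈z) → within (P.Eq.trans i x≈y y≈z) }
        }
      ; reflexive     = λ { (within {i} x≈y) → within (P.reflexive i x≈y) }
      ; trans         = ⊑-trans
      }
    ; P⁺         = λ (i , x) → P.P⁺ i x
    ; P⁻         = λ (i , x) → P.P⁻ i x
    ; P⁺-resp    = λ { (within {i} x≈y) → P.P⁺-resp i x≈y }
    ; P⁻-resp    = λ { (within {i} x≈y) → P.P⁻-resp i x≈y }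
    }
    where
    ⊑-trans : ∀ {x y z} → ⨁-⊑ x y → ⨁-⊑ y z → ⨁-⊑ x z
    ⊑-trans (between i<j)      (between j<k) = between (C.trans i<j j<k)
    ⊑-trans (between i<j)      (within _)    = between i<j
    ⊑-trans (within _)         (between i<j) = between i<j
    ⊑-trans (within {i} x⊑y)   (within y⊑z)  = within (P.trans i x⊑y y⊑z)

-- A subset L ⊆ I is given by its characteristic function, which loses
-- no generality in the presence of excluded middle.

layers : {I : Set} → (I → Bool) → I → EP
layers L i = if L i then 𝟐ᴸ else 𝟐ᴿ

data VerticalCrown : Set where
  crown-ℤ   : (L : ℤ → Bool) → VerticalCrown
  crown-ℕ   : (L : ℕ → Bool) → VerticalCrown
  crown-ℕ∂  : (L : ℕ → Bool) → VerticalCrown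
  crown-Fin : (n : ℕ) (L : Fin n → Bool) → VerticalCrown

-- The part of a crown strictly below its identity element.
body : VerticalCrown → EP
body (crown-ℤ L)     = ⨁ ℤ.<-isStrictTotalOrder (layers L)
body (crown-ℕ L)     = 𝟏ᴿ ⊕ ⨁ ℕ.<-isStrictTotalOrder (layers L)
body (crown-ℕ∂ L)    = ⨁ (Flip.isStrictTotalOrder ℕ.<-isStrictTotalOrder) (layers L) ⊕ 𝟏ᴸ
body (crown-Fin n L) = 𝟏ᴿ ⊕ ⨁ (Fin.<-isStrictTotalOrder {n}) (layers L) ⊕ 𝟏ᴸ

-- P ⊕ 𝟏ᴸ with its top element, the identity, also made negative.
withIdentity : EP → EP
withIdentity P = record
  { Carrier    = Carrier
  ; _≈_        = _≈_
  ; _⊑_        = _⊑_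
  ; isPreorder = isPreorder
  ; P⁺         = P⁺
  ; P⁻         = λ x → x ∈ P⁻ ⊎ x ≈ inj₂ tt
  ; P⁺-resp    = P⁺-resp
  ; P⁻-resp    = λ { x≈y (inj₁ p) → inj₁ (P⁻-resp x≈y p)
                   ; x≈y (inj₂ p) → inj₂ (Eq.trans (Eq.sym x≈y) p) }
  }
  where open EnhancedPreorder (P ⊕ 𝟏ᴸ)

crown : VerticalCrown → EP
crown C = withIdentity (body C)

crownIdentity : (C : VerticalCrown) → EnhancedPreorder.Carrier (crown C)
crownIdentity C = inj₂ tt

Crownian : IdempotentResiduatedChain c ℓ₁ ℓ₂ → Set (c ⊔ ℓ₁ ⊔ ℓ₂)
Crownian A =
  Σ VerticalCrown λ C →
  Σ (Isomorphism (crown C) (enhancedMonoidalPreorder A)) λ φ →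
  Isomorphism.to φ (crownIdentity C) ≈ 1#
  where open IdempotentResiduatedChain A

{-# OPTIONS --safe #-}
module Submission where

-- Products are selective (x ∙ y is x or y), so ⊑ is governed by which pairs
-- commute: a pair of commuting, distinct elements is strictly ordered, and
-- associativity shows that no element fails to commute with two different
-- ones.  A layer is therefore a single element or a noncommuting pair
-- consisting of one positive and one negative element.  Each of x ˡ and x ʳ is
-- x ⋆ or the noncommuting partner of x, so ⟨ x ⟩ is the connected component of
-- x in the graph formed by ⋆ and partnership.  If ⋆ is an involution, then it
-- pairs each negative x with a positive cover x ⋆ of x in ⊏.  Hence the graph
-- is a union of paths climbing through the layers without gaps, which gives
-- convexity; a single path is a crown, whose type records at which ends the
-- path stops, namely at elements without a partner.

open import Axiom.ExcludedMiddle using (ExcludedMiddle)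
open import Data.Bool.Base using (Bool; true; false; if_then_else_)
open import Data.Empty using (⊥-elim)
open import Data.Fin.Base as Fin using (Fin; toℕ; fromℕ<)
import Data.Fin.Properties as Fin
open import Data.Integer.Base as ℤ using (ℤ; +_; -[1+_]; +<+; -<-; -<+)
import Data.Integer.Properties as ℤ
open import Data.Nat.Base as ℕ using (ℕ; zero; suc; z≤n; s≤s; z<s; s<s)
open import Data.Nat.Induction using (<-rec)
import Data.Nat.Properties as ℕ
open import Data.Product.Base using (Σ; ∃; _×_; _,_; proj₁; proj₂; swap)
open import Data.Sum.Base as Sum using (_⊎_; inj₁; inj₂; [_,_]′)
open import Data.Sum.Relation.Binary.LeftOrder using (₁∼₁; ₁∼₂; ₂∼₂; drop-inj₁)
open import Data.Sum.Relation.Binary.Pointwise using (inj₁; inj₂)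
open import Data.Unit.Base using (tt)
open import Function.Base using (_∘_; flip; id)
open import Function.Bundles using (_⇔_; mk⇔; module Equivalence)
open import Level using (Level; _⊔_; 0ℓ; Lift; lift; lower)
import Relation.Binary.Construct.Flip.EqAndOrd as Flip
open import Relation.Binary.Core using (Rel)
open import Relation.Binary.Definitions using (_Respects_; tri<; tri≈; tri>)
open import Relation.Binary.Morphism.Structures using (IsOrderIsomorphism)
open import Relation.Binary.PropositionalEquality.Core as ≡ using (_≡_)
open import Relation.Binary.Structures using (IsStrictTotalOrder)
open import Relation.Nullary.Decidable.Core
  using (Dec; yes; no; does; map′; decidable-stable; ¬?)
open import Relation.Nullary.Negation.Core using (¬_; contradiction)
open import Relation.Unary using (Pred; _∈_; Decidable)
open import Defs

open Equivalence using (to; from)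

-- A crown isomorphism transports only `⊑` and signs, so `⋆` has to be recovered from these. The key
-- is that, for negative x and positive y, `x ≤ y ⋆` holds exactly when `x ⊏ y`; hence `⋆` exchanges
-- the two ends of every negative-positive cover in `⊏`. Integer ranks with covers between
-- consecutive ranks then allow one argument for all four crowns. In the other direction, meet, join
-- and product are selective, and each residual is its numerator or the `ʳ` or `ˡ` of its
-- denominator; so generating as a residuated lattice adds only `1#` to `⟨ g ⟩`. A path is best
-- unrolled from an end. Its edges are symmetric, so every non-identity element generates as soon as
-- one does, and an end may replace the given generator. Excluded middle decides whether elements
-- commute, whether partners exist, and which layers belong to L.

private
  module EP P = EnhancedPreorder {0ℓ} {0ℓ} {0ℓ} {0ℓ} P

-- Noncommuting pairs and the operation ⋆

-- Reversing products exchanges the two residuals, so selectivity needs a proof for only one of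
-- them.
opposite : ∀ {c ℓ₁ ℓ₂} → IdempotentResiduatedChain c ℓ₁ ℓ₂ → IdempotentResiduatedChain c ℓ₁ ℓ₂
opposite A = record
  { residuatedLattice = record
    { Carrier    = Carrier
    ; _≈_        = _≈_
    ; _≤_        = _≤_
    ; _∧_        = _∧_
    ; _∨_        = _∨_
    ; _∙_        = flip _∙_
    ; _\\_       = flip _//_
    ; _//_       = flip _\\_
    ; 1#         = 1#
    ; isLattice  = isLattice
    ; isMonoid   = record
      { isSemigroup = record
        { isMagma = record
          { isEquivalence = isEquivalence
          ; ∙-cong        = flip ∙-cong
          }
        ; assoc   = λ x y z → ≈-sym (assoc z y x)
        }
      ; identity    = swap identity
      }
    ; \\-residual = λ x y z → //-residual y x z
    ; //-residual = λ x y z → \\-residual y x z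
    }
  ; total = total
  ; idem  = idem
  }
  where open IdempotentResiduatedChain A

module Chain {c ℓ₁ ℓ₂ : Level} (A : IdempotentResiduatedChain c ℓ₁ ℓ₂) where
  open IdempotentResiduatedChain A
  open EnhancedPreorder (enhancedMonoidalPreorder A) public
    using (_⊑_) renaming (trans to ⊑-trans)
  open Layers (enhancedMonoidalPreorder A) public

  -- Selectivity of products and residuals

  ≤-refl : ∀ {x} → x ≤ x
  ≤-refl = reflexive ≈-refl

  ∙-monoʳ-≤ : ∀ x {y z} → y ≤ z → x ∙ y ≤ x ∙ z
  ∙-monoʳ-≤ x y≤z = to (\\-residual _ _ _) (trans y≤z (from (\\-residual _ _ _) ≤-refl))

  ∙-monoˡ-≤ : ∀ x {y z} → y ≤ z → y ∙ x ≤ z ∙ x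
  ∙-monoˡ-≤ x y≤z = to (//-residual _ _ _) (trans y≤z (from (//-residual _ _ _) ≤-refl))

  x≤y⇒x≤x∙y : ∀ {x y} → x ≤ y → x ≤ x ∙ y
  x≤y⇒x≤x∙y {x} x≤y = trans (reflexive (≈-sym (idem x))) (∙-monoʳ-≤ x x≤y)

  x≤y⇒x∙y≤y : ∀ {x y} → x ≤ y → x ∙ y ≤ y
  x≤y⇒x∙y≤y {_} {y} x≤y = trans (∙-monoˡ-≤ y x≤y) (reflexive (idem y))

  y≤x⇒y≤x∙y : ∀ {x y} → y ≤ x → y ≤ x ∙ y
  y≤x⇒y≤x∙y {_} {y} y≤x = trans (reflexive (≈-sym (idem y))) (∙-monoˡ-≤ y y≤x)

  y≤x⇒x∙y≤x : ∀ {x y} → y ≤ x → x ∙ y ≤ x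
  y≤x⇒x∙y≤x {x} y≤x = trans (∙-monoʳ-≤ x y≤x) (reflexive (idem x))

  x∙[x∙y]≈x∙y : ∀ x y → x ∙ (x ∙ y) ≈ x ∙ y
  x∙[x∙y]≈x∙y x y = ≈-trans (≈-sym (assoc x x y)) (∙-congʳ (idem x))

  [x∙y]∙y≈x∙y : ∀ x y → (x ∙ y) ∙ y ≈ x ∙ y
  [x∙y]∙y≈x∙y x y = ≈-trans (assoc x y y) (∙-congˡ (idem y))

  x∙y≤1⇒x∙y≤x : ∀ {x y} → x ∙ y ≤ 1# → x ∙ y ≤ x
  x∙y≤1⇒x∙y≤x {x} {y} p =
    ≤-respˡ-≈ (x∙[x∙y]≈x∙y x y) (≤-respʳ-≈ (identityʳ x) (∙-monoʳ-≤ x p))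

  x∙y≤1⇒x∙y≤y : ∀ {x y} → x ∙ y ≤ 1# → x ∙ y ≤ y
  x∙y≤1⇒x∙y≤y {x} {y} p =
    ≤-respˡ-≈ ([x∙y]∙y≈x∙y x y) (≤-respʳ-≈ (identityˡ y) (∙-monoˡ-≤ y p))

  1≤x∙y⇒x≤x∙y : ∀ {x y} → 1# ≤ x ∙ y → x ≤ x ∙ y
  1≤x∙y⇒x≤x∙y {x} {y} p =
    ≤-respˡ-≈ (identityʳ x) (≤-respʳ-≈ (x∙[x∙y]≈x∙y x y) (∙-monoʳ-≤ x p))

  1≤x∙y⇒y≤x∙y : ∀ {x y} → 1# ≤ x ∙ y → y ≤ x ∙ y
  1≤x∙y⇒y≤x∙y {x} {y} p =
    ≤-respˡ-≈ (identityˡ y) (≤-respʳ-≈ ([x∙y]∙y≈x∙y x y) (∙-monoˡ-≤ y p))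

  -- A product below `1#` is the meet of its factors and a product above `1#` is their join. For
  -- instance, multiplying `x ∙ y ≤ 1#` by x on the left gives `x ∙ y ≤ x` by idempotence, while
  -- monotonicity keeps `x ∙ y` between x and y.
  ∙-sel : ∀ x y → x ∙ y ≈ x ⊎ x ∙ y ≈ y
  ∙-sel x y with total (x ∙ y) 1# | total x y
  ... | inj₁ p | inj₁ x≤y = inj₁ (antisym (x∙y≤1⇒x∙y≤x p) (x≤y⇒x≤x∙y x≤y))
  ... | inj₁ p | inj₂ y≤x = inj₂ (antisym (x∙y≤1⇒x∙y≤y p) (y≤x⇒y≤x∙y y≤x))
  ... | inj₂ p | inj₁ x≤y = inj₂ (antisym (x≤y⇒x∙y≤y x≤y) (1≤x∙y⇒y≤x∙y p))
  ... | inj₂ p | inj₂ y≤x = inj₁ (antisym (y≤x⇒x∙y≤x y≤x) (1≤x∙y⇒x≤x∙y p))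

  positive-∙ : ∀ {x y} → 1# ≤ x → x ≤ y → x ∙ y ≈ y × y ∙ x ≈ y
  positive-∙ {x} {y} 1≤x x≤y =
      antisym (x≤y⇒x∙y≤y x≤y) (≤-respˡ-≈ (identityˡ y) (∙-monoˡ-≤ y 1≤x))
    , antisym (y≤x⇒x∙y≤x x≤y) (≤-respˡ-≈ (identityʳ y) (∙-monoʳ-≤ y 1≤x))

  negative-∙ : ∀ {x y} → y ≤ 1# → x ≤ y → x ∙ y ≈ x × y ∙ x ≈ x
  negative-∙ {x} {y} y≤1 x≤y =
      antisym (≤-respʳ-≈ (identityʳ x) (∙-monoʳ-≤ x y≤1)) (x≤y⇒x≤x∙y x≤y)
    , antisym (≤-respʳ-≈ (identityˡ x) (∙-monoˡ-≤ x y≤1)) (y≤x⇒y≤x∙y x≤y)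

  x∙xʳ≤1 : ∀ x → x ∙ x ʳ ≤ 1#
  x∙xʳ≤1 x = to (\\-residual _ _ _) ≤-refl

  xˡ∙x≤1 : ∀ x → x ˡ ∙ x ≤ 1#
  xˡ∙x≤1 x = to (//-residual _ _ _) ≤-refl

  module _ (x z : Carrier) where
    private
      w = x \\ z

      x∙w≤z : x ∙ w ≤ z
      x∙w≤z = to (\\-residual _ _ _) ≤-refl

      ≤w : ∀ {y} → x ∙ y ≤ z → y ≤ w
      ≤w = from (\\-residual _ _ _)

      ≤xʳ : ∀ {y} → x ∙ y ≤ 1# → y ≤ x ʳ
      ≤xʳ = from (\\-residual _ _ _)

      w≤xʳ⊎w≤z : w ≤ x ʳ ⊎ w ≤ z
      w≤xʳ⊎w≤z with ∙-sel x w | total x 1#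
      ... | inj₂ xw≈w | _        = inj₂ (≤-respˡ-≈ xw≈w x∙w≤z)
      ... | inj₁ xw≈x | inj₁ x≤1 = inj₁ (≤xʳ (≤-respˡ-≈ (≈-sym xw≈x) x≤1))
      ... | inj₁ _    | inj₂ 1≤x =
        inj₂ (trans (≤-respˡ-≈ (identityˡ w) (∙-monoˡ-≤ w 1≤x)) x∙w≤z)

      sel-≤ : x ≤ z → w ≈ x ʳ ⊎ w ≈ z
      sel-≤ x≤z = Sum.map
        (λ w≤xʳ → antisym w≤xʳ (≤w (trans (x∙y≤1⇒x∙y≤x (x∙xʳ≤1 x)) x≤z)))
        (λ w≤z → antisym w≤z (≤w (x≤y⇒x∙y≤y x≤z)))
        w≤xʳ⊎w≤z

      sel-≥ : z ≤ x → w ≈ x ʳ ⊎ w ≈ z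
      sel-≥ z≤x with ∙-sel x w | total (x ʳ) z
      ... | inj₁ xw≈x | _ = sel-≤ (≤-respˡ-≈ xw≈x x∙w≤z)
      ... | inj₂ xw≈w | inj₁ xʳ≤z with total w 1#
      ...   | inj₁ w≤1 = inj₁ (antisym (≤xʳ (≤-respˡ-≈ (≈-sym xw≈w) w≤1))
                                       (≤w (trans (x∙y≤1⇒x∙y≤y (x∙xʳ≤1 x)) xʳ≤z)))
      -- Here `1# ≤ w ≤ x`, so `x ∙ w` is x and therefore `x ≤ z`: the case already settled.
      ...   | inj₂ 1≤w = sel-≤ (≤-respˡ-≈ (proj₂ (positive-∙ 1≤w w≤x)) x∙w≤z)
        where w≤x = trans (≤-respˡ-≈ xw≈w x∙w≤z) z≤x
      sel-≥ z≤x | inj₂ xw≈w | inj₂ z≤xʳ =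
        inj₂ (antisym (≤-respˡ-≈ xw≈w x∙w≤z)
                      (≤w (x∙y≤1⇒x∙y≤y (to (\\-residual _ _ _) z≤xʳ))))

    -- Let w be the residual. As `x ∙ w` is x or w, the inequality `x ∙ w ≤ z` bounds w by `x ʳ` or
    -- by z, and the maximality of w gives the reverse bound. Division therefore creates nothing new
    -- beyond division into `1#`.
    \\-sel : x \\ z ≈ x ʳ ⊎ x \\ z ≈ z
    \\-sel = [ sel-≤ , sel-≥ ]′ (total x z)

  -- Signs and noncommuting pairs

  Positive Negative : Pred Carrier (ℓ₁ ⊔ ℓ₂)
  Positive x = 1# ≤ x × ¬ x ≈ 1#
  Negative x = x ≤ 1# × ¬ x ≈ 1#

  sign : ∀ {x} → ¬ x ≈ 1# → Positive x ⊎ Negative x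
  sign {x} x≉1 = Sum.map (_, x≉1) (_, x≉1) (total 1# x)

  infix 4 _∥_

  _∥_ : Carrier → Carrier → Set ℓ₁
  x ∥ y = ¬ x ∙ y ≈ y ∙ x

  ∥-sym : ∀ {x y} → x ∥ y → y ∥ x
  ∥-sym x∥y = x∥y ∘ ≈-sym

  ∥-respˡ : ∀ {x y z} → x ≈ y → x ∥ z → y ∥ z
  ∥-respˡ x≈y x∥z yz≈zy = x∥z (≈-trans (∙-congʳ x≈y) (≈-trans yz≈zy (∙-congˡ (≈-sym x≈y))))

  ∥⇒≉ : ∀ {x y} → x ∥ y → ¬ x ≈ y
  ∥⇒≉ x∥y x≈y = x∥y (≈-trans (∙-congʳ x≈y) (∙-congˡ (≈-sym x≈y)))

  1∦ : ∀ {x y} → x ≈ 1# → ¬ x ∥ y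
  1∦ {_} {y} x≈1 x∥y = x∥y (≈-trans (≈-trans (∙-congʳ x≈1) (identityˡ y))
                       (≈-sym (≈-trans (∙-congˡ x≈1) (identityʳ y))))

  positive-comm : ∀ {x y} → 1# ≤ x → 1# ≤ y → x ∙ y ≈ y ∙ x
  positive-comm {x} {y} 1≤x 1≤y with total x y
  ... | inj₁ x≤y = let p , q = positive-∙ 1≤x x≤y in ≈-trans p (≈-sym q)
  ... | inj₂ y≤x = let p , q = positive-∙ 1≤y y≤x in ≈-trans q (≈-sym p)

  negative-comm : ∀ {x y} → x ≤ 1# → y ≤ 1# → x ∙ y ≈ y ∙ x
  negative-comm {x} {y} x≤1 y≤1 with total x y
  ... | inj₁ x≤y = let p , q = negative-∙ y≤1 x≤y in ≈-trans p (≈-sym q)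
  ... | inj₂ y≤x = let p , q = negative-∙ x≤1 y≤x in ≈-trans q (≈-sym p)

  ∥-positive : ∀ {x y} → Positive x → x ∥ y → Negative y
  ∥-positive {x} {y} (1≤x , _) x∥y = y≤1 , λ y≈1 → 1∦ y≈1 (∥-sym x∥y)
    where
    y≤1 : y ≤ 1#
    y≤1 with total y 1#
    ... | inj₁ y≤1 = y≤1
    ... | inj₂ 1≤y = contradiction (positive-comm 1≤x 1≤y) x∥y

  ∥-negative : ∀ {x y} → Negative x → x ∥ y → Positive y
  ∥-negative {x} {y} (x≤1 , _) x∥y = 1≤y , λ y≈1 → 1∦ y≈1 (∥-sym x∥y)
    where
    1≤y : 1# ≤ y
    1≤y with total y 1#
    ... | inj₁ y≤1 = contradiction (negative-comm x≤1 y≤1) x∥y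
    ... | inj₂ 1≤y = 1≤y

  -- The two-element left-zero and right-zero bands. In the first, x and y are `⊑`-equivalent, as in
  -- `𝟐ᴸ`; in the second they are incomparable, as in `𝟐ᴿ`.
  data Absorption (x y : Carrier) : Set ℓ₁ where
    left-zero  : x ∙ y ≈ x → y ∙ x ≈ y → Absorption x y
    right-zero : x ∙ y ≈ y → y ∙ x ≈ x → Absorption x y

  ∥-absorption : ∀ {x y} → x ∥ y → Absorption x y
  ∥-absorption {x} {y} x∥y with ∙-sel x y | ∙-sel y x
  ... | inj₁ p | inj₁ q = left-zero p q
  ... | inj₁ p | inj₂ q = contradiction (≈-trans p (≈-sym q)) x∥y
  ... | inj₂ p | inj₁ q = contradiction (≈-trans p (≈-sym q)) x∥y
  ... | inj₂ p | inj₂ q = right-zero p q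

  private
    triple : ∀ x y z {u v} → x ∙ y ≈ u → y ∙ z ≈ v → u ∙ z ≈ x ∙ v
    triple x y z p q = ≈-trans (∙-congʳ (≈-sym p)) (≈-trans (assoc x y z) (∙-congˡ q))

    -- Each case evaluates one product of x, y and z under both bracketings.
    ∥-unique-⊑ : ∀ {x y z} → x ∥ y → x ∥ z → y ∙ z ≈ y → z ∙ y ≈ y → y ≈ z
    ∥-unique-⊑ {x} {y} {z} x∥y x∥z yz zy with ∥-absorption x∥y | ∥-absorption x∥z
    ... | left-zero xy yx | left-zero xz zx =
      ≈-trans (≈-sym zy) (≈-trans (triple z x y zx xy) zx)
    ... | right-zero xy yx | right-zero xz zx =
      ≈-trans (≈-sym yz) (≈-trans (≈-sym (triple y x z yx xz)) xz)
    ... | left-zero xy yx | right-zero xz zx =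
      contradiction (≈-trans (≈-sym xy) (≈-trans (≈-sym (triple x z y xz zy)) zy)) (∥⇒≉ x∥y)
    ... | right-zero xy yx | left-zero xz zx =
      contradiction (≈-trans (≈-sym yx) (≈-trans (triple y z x yz zx) yz)) (∥⇒≉ x∥y)

    ∥-comm : ∀ {x y z} → x ∥ y → x ∥ z → y ∙ z ≈ z ∙ y
    ∥-comm x∥y x∥z with sign (λ x≈1 → 1∦ x≈1 x∥y)
    ... | inj₁ x⁺ = negative-comm (proj₁ (∥-positive x⁺ x∥y)) (proj₁ (∥-positive x⁺ x∥z))
    ... | inj₂ x⁻ = positive-comm (proj₁ (∥-negative x⁻ x∥y)) (proj₁ (∥-negative x⁻ x∥z))

  -- Two partners of x both have the sign opposite to that of x, hence commute, and selectivity puts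
  -- one of them `⊑`-below the other.
  ∥-unique : ∀ {x y z} → x ∥ y → x ∥ z → y ≈ z
  ∥-unique {x} {y} {z} x∥y x∥z with ∙-sel y z | ∥-comm x∥y x∥z
  ... | inj₁ yz≈y | comm = ∥-unique-⊑ x∥y x∥z yz≈y (≈-trans (≈-sym comm) yz≈y)
  ... | inj₂ yz≈z | comm =
    ≈-sym (∥-unique-⊑ x∥z x∥y (≈-trans (≈-sym comm) yz≈z) yz≈z)

  ⊏-trans : ∀ {x y z} → x ⊏ y → y ⊏ z → x ⊏ z
  ⊏-trans (x⊑y , y⋢x) (y⊑z , z⋢y) =
    ⊑-trans x⊑y y⊑z , λ z⊑x → y⋢x (⊑-trans y⊑z z⊑x)

  ⊏-intro : ∀ {x y} → x ∙ y ≈ x → y ∙ x ≈ x → ¬ x ≈ y → x ⊏ y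
  ⊏-intro xy≈x yx≈x x≉y = xy≈x , λ yx≈y → x≉y (≈-trans (≈-sym yx≈x) yx≈y)

  ⊏⇒∙≈ : ∀ {x y} → x ⊏ y → y ∙ x ≈ x
  ⊏⇒∙≈ {x} {y} (_ , y⋢x) = [ (λ yx≈y → contradiction yx≈y y⋢x) , id ]′ (∙-sel y x)

  ⊏⇒≉ : ∀ {x y} → x ⊏ y → ¬ x ≈ y
  ⊏⇒≉ (_ , y⋢x) x≈y = y⋢x (≈-trans (∙-congˡ x≈y) (idem _))

  ⊏⇒∦ : ∀ {x y} → x ⊏ y → ¬ x ∥ y
  ⊏⇒∦ x⊏y x∥y = x∥y (≈-trans (proj₁ x⊏y) (≈-sym (⊏⇒∙≈ x⊏y)))

  ⊏-asym : ∀ {x y} → x ⊏ y → ¬ y ⊏ x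
  ⊏-asym (x⊑y , _) (_ , x⋢y) = x⋢y x⊑y

  ⊏-respʳ-≈ : ∀ {x y z} → y ≈ z → x ⊏ y → x ⊏ z
  ⊏-respʳ-≈ y≈z (xy≈x , y⋢x) =
      ≈-trans (∙-congˡ (≈-sym y≈z)) xy≈x
    , λ zx≈z → y⋢x (≈-trans (∙-congʳ y≈z) (≈-trans zx≈z (≈-sym y≈z)))

  ⊏-respˡ-≈ : ∀ {x y z} → x ≈ y → x ⊏ z → y ⊏ z
  ⊏-respˡ-≈ x≈y (xz≈x , z⋢x) =
      ≈-trans (∙-congʳ (≈-sym x≈y)) (≈-trans xz≈x x≈y)
    , λ zy≈z → z⋢x (≈-trans (∙-congˡ x≈y) zy≈z)

  ⊏⇒≉1 : ∀ {x y} → x ⊏ y → ¬ x ≈ 1#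
  ⊏⇒≉1 {_} {y} (_ , y⋢x) x≈1 = y⋢x (≈-trans (∙-congˡ x≈1) (identityʳ y))

  positive-⊏ : ∀ {x y} → 1# ≤ x → x ≤ y → ¬ x ≈ y → y ⊏ x
  positive-⊏ 1≤x x≤y x≉y =
    let p , q = positive-∙ 1≤x x≤y in ⊏-intro q p (x≉y ∘ ≈-sym)

  negative-⊏ : ∀ {x y} → y ≤ 1# → x ≤ y → ¬ x ≈ y → x ⊏ y
  negative-⊏ y≤1 x≤y x≉y = let p , q = negative-∙ y≤1 x≤y in ⊏-intro p q x≉y

  -- The operation `⋆` in terms of `⊏`

  ⋆-greatest : ∀ {x y} → y ∙ x ≤ 1# → x ∙ y ≤ 1# → y ≤ x ⋆
  ⋆-greatest yx≤1 xy≤1 =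
    ∧-greatest (from (//-residual _ _ _) yx≤1) (from (\\-residual _ _ _) xy≤1)

  ≤⋆⇒∙≤1 : ∀ {x y} → y ≤ x ⋆ → y ∙ x ≤ 1# × x ∙ y ≤ 1#
  ≤⋆⇒∙≤1 {x} y≤x⋆ = to (//-residual _ _ _) (trans y≤x⋆ (x∧y≤x (x ˡ) (x ʳ)))
                  , to (\\-residual _ _ _) (trans y≤x⋆ (x∧y≤y (x ˡ) (x ʳ)))

  -- The condition that both `x ∙ y` and `y ∙ x` are at most `1#` is symmetric in x and y, so `⋆`
  -- forms an antitone Galois connection with itself.
  ⋆-galois : ∀ {x y} → y ≤ x ⋆ → x ≤ y ⋆
  ⋆-galois y≤x⋆ = let p , q = ≤⋆⇒∙≤1 y≤x⋆ in ⋆-greatest q p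

  ⋆-cong : ∀ {x y} → x ≈ y → x ⋆ ≈ y ⋆
  ⋆-cong x≈y = antisym (⋆-galois (trans (reflexive (≈-sym x≈y)) (⋆-galois ≤-refl)))
                       (⋆-galois (trans (reflexive x≈y) (⋆-galois ≤-refl)))

  1⋆≈1 : 1# ⋆ ≈ 1#
  1⋆≈1 = antisym (≤-respˡ-≈ (identityʳ _) (proj₁ (≤⋆⇒∙≤1 ≤-refl)))
                 (⋆-greatest (reflexive (identityˡ 1#)) (reflexive (identityˡ 1#)))

  ˡ≤ʳ⇒⋆≈ˡ : ∀ {x} → x ˡ ≤ x ʳ → x ⋆ ≈ x ˡ
  ˡ≤ʳ⇒⋆≈ˡ p = antisym (x∧y≤x _ _) (∧-greatest ≤-refl p)

  ʳ≤ˡ⇒⋆≈ʳ : ∀ {x} → x ʳ ≤ x ˡ → x ⋆ ≈ x ʳ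
  ʳ≤ˡ⇒⋆≈ʳ p = antisym (x∧y≤y _ _) (∧-greatest p ≤-refl)

  ⋆-sel : ∀ x → x ⋆ ≈ x ˡ ⊎ x ⋆ ≈ x ʳ
  ⋆-sel x = Sum.map ˡ≤ʳ⇒⋆≈ˡ ʳ≤ˡ⇒⋆≈ʳ (total (x ˡ) (x ʳ))

  positive-⋆ : ∀ {x} → Positive x → Negative (x ⋆)
  positive-⋆ {x} (1≤x , x≉1) =
      ≤-respˡ-≈ (identityʳ _) (trans (∙-monoʳ-≤ _ 1≤x) (proj₁ (≤⋆⇒∙≤1 ≤-refl)))
    , λ x⋆≈1 → x≉1 (antisym (≤-respˡ-≈ (identityˡ x)
        (proj₁ (≤⋆⇒∙≤1 (reflexive (≈-sym x⋆≈1))))) 1≤x)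

  1≤negative⋆ : ∀ {x} → x ≤ 1# → 1# ≤ x ⋆
  1≤negative⋆ x≤1 = ⋆-greatest (trans (reflexive (identityˡ _)) x≤1)
                               (trans (reflexive (identityʳ _)) x≤1)

  -- Both products are at most `1#`, hence are not the strictly positive y, and selectivity leaves
  -- x. With the converse `⊏⇒≤⋆` this is the dictionary between `⋆` and `⊏`.
  ≤⋆⇒⊏ : ∀ {x y} → Negative x → Positive y → x ≤ y ⋆ → x ⊏ y
  ≤⋆⇒⊏ {x} {y} (x≤1 , _) (1≤y , y≉1) x≤y⋆ =
    ⊏-intro ([ id , (λ xy≈y → contradiction (≤-respˡ-≈ xy≈y xy≤1) y≰1) ]′ (∙-sel x y))
            ([ (λ yx≈y → contradiction (≤-respˡ-≈ yx≈y yx≤1) y≰1) , id ]′ (∙-sel y x))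
            (λ x≈y → y≰1 (≤-respˡ-≈ x≈y x≤1))
    where
    xy≤1 = proj₁ (≤⋆⇒∙≤1 x≤y⋆)
    yx≤1 = proj₂ (≤⋆⇒∙≤1 x≤y⋆)
    y≰1 = λ y≤1 → y≉1 (antisym y≤1 1≤y)

  ⊏⇒≤⋆ : ∀ {x y} → x ≤ 1# → x ⊏ y → x ≤ y ⋆
  ⊏⇒≤⋆ x≤1 x⊏y = ⋆-greatest (trans (reflexive (proj₁ x⊏y)) x≤1)
                            (trans (reflexive (⊏⇒∙≈ x⊏y)) x≤1)

  ⋆⊏ : ∀ {x} → Positive x → x ⋆ ⊏ x
  ⋆⊏ x⁺ = ≤⋆⇒⊏ (positive-⋆ x⁺) x⁺ ≤-refl

  ⟨⟩⊆Sg : ∀ {g x} → x ∈ ⟨ g ⟩ → x ∈ Sg g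
  ⟨⟩⊆Sg base         = gen
  ⟨⟩⊆Sg (left x∈)    = rdiv unit (⟨⟩⊆Sg x∈)
  ⟨⟩⊆Sg (right x∈)   = ldiv (⟨⟩⊆Sg x∈) unit
  ⟨⟩⊆Sg (resp eq x∈) = resp eq (⟨⟩⊆Sg x∈)

  ⟨⟩-trans : ∀ {x y z} → x ∈ ⟨ y ⟩ → y ∈ ⟨ z ⟩ → x ∈ ⟨ z ⟩
  ⟨⟩-trans base         y∈ = y∈
  ⟨⟩-trans (left x∈)    y∈ = left (⟨⟩-trans x∈ y∈)
  ⟨⟩-trans (right x∈)   y∈ = right (⟨⟩-trans x∈ y∈)
  ⟨⟩-trans (resp eq x∈) y∈ = resp eq (⟨⟩-trans x∈ y∈)

-- Excluded middle is given only at the join of the levels; q supplies the part of that join by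
-- which P has to be lifted.
decide : ∀ {p} q → ExcludedMiddle (p ⊔ q) → (P : Set p) → Dec P
decide {p} q em P = map′ lower lift (em {Lift (p ⊔ q) P})

-- Partners and generated sets

module ClassicalChain {c ℓ₁ ℓ₂ : Level} (em : ExcludedMiddle (c ⊔ ℓ₁ ⊔ ℓ₂))
                      (A : IdempotentResiduatedChain c ℓ₁ ℓ₂) where
  open IdempotentResiduatedChain A
  open Chain A

  infix 4 _≈?_

  _≈?_ : ∀ x y → Dec (x ≈ y)
  x ≈? y = decide (c ⊔ ℓ₂) em (x ≈ y)

  -- If x commutes with `x ˡ`, then `x ∙ x ˡ ≤ 1#` too, so `x ˡ ≤ x ʳ` and the meet defining `x ⋆`
  -- is `x ˡ`.
  ˡ-sel : ∀ x → x ⋆ ≈ x ˡ ⊎ x ∥ x ˡ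
  ˡ-sel x with x ∙ x ˡ ≈? x ˡ ∙ x
  ... | no x∥xˡ  = inj₂ x∥xˡ
  ... | yes comm = inj₁ (ˡ≤ʳ⇒⋆≈ˡ
    (from (\\-residual _ _ _) (≤-respˡ-≈ (≈-sym comm) (xˡ∙x≤1 x))))

  ʳ-sel : ∀ x → x ⋆ ≈ x ʳ ⊎ x ∥ x ʳ
  ʳ-sel x with x ∙ x ʳ ≈? x ʳ ∙ x
  ... | no x∥xʳ  = inj₂ x∥xʳ
  ... | yes comm = inj₁ (ʳ≤ˡ⇒⋆≈ʳ (from (//-residual _ _ _) (≤-respˡ-≈ comm (x∙xʳ≤1 x))))

  data Comparison (x y : Carrier) : Set ℓ₁ where
    below      : x ⊏ y → Comparison x y
    above      : y ⊏ x → Comparison x y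
    equal      : x ≈ y → Comparison x y
    noncommute : x ∥ y → Comparison x y

  compare : ∀ x y → Comparison x y
  compare x y with x ∙ y ≈? y ∙ x | x ≈? y | ∙-sel x y
  ... | no x∥y   | _       | _         = noncommute x∥y
  ... | yes _    | yes x≈y | _         = equal x≈y
  ... | yes comm | no x≉y  | inj₁ xy≈x = below (⊏-intro xy≈x (≈-trans (≈-sym comm) xy≈x) x≉y)
  ... | yes comm | no x≉y  | inj₂ xy≈y =
    above (⊏-intro (≈-trans (≈-sym comm) xy≈y) xy≈y (x≉y ∘ ≈-sym))

  ≤ᴸ-cases : ∀ {x y} → x ≤ᴸ y → x ⊏ y ⊎ x ≈ y ⊎ x ∥ y
  ≤ᴸ-cases {x} {y} x≤y with compare x y
  ... | below x⊏y      = inj₁ x⊏y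
  ... | equal x≈y      = inj₂ (inj₁ x≈y)
  ... | noncommute x∥y = inj₂ (inj₂ x∥y)
  ... | above y⊏x@(_ , x⋢y) with x≤y
  ...   | inj₁ (_ , same) = contradiction (to (same y) y⊏x) (λ (_ , y⋢y) → y⋢y (idem y))
  ...   | inj₂ x⊑y        = contradiction x⊑y x⋢y

  ⊏-respʳ-∥ : ∀ {x y z} → x ⊏ y → y ∥ z → x ⊏ z
  ⊏-respʳ-∥ {x} {y} {z} x⊏y y∥z with compare x z
  ... | below x⊏z      = x⊏z
  ... | above z⊏x      = contradiction (∥-sym y∥z) (⊏⇒∦ (⊏-trans z⊏x x⊏y))
  ... | equal x≈z      = contradiction (∥-respˡ (≈-sym x≈z) (∥-sym y∥z)) (⊏⇒∦ x⊏y)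
  ... | noncommute x∥z = contradiction (∥-unique (∥-sym x∥z) (∥-sym y∥z)) (⊏⇒≉ x⊏y)

  ⊏-respˡ-∥ : ∀ {x y z} → x ⊏ y → x ∥ z → z ⊏ y
  ⊏-respˡ-∥ {x} {y} {z} x⊏y x∥z with compare z y
  ... | below z⊏y      = z⊏y
  ... | above y⊏z      = contradiction x∥z (⊏⇒∦ (⊏-trans x⊏y y⊏z))
  ... | equal z≈y      = contradiction (∥-sym (∥-respˡ z≈y (∥-sym x∥z))) (⊏⇒∦ x⊏y)
  ... | noncommute z∥y = contradiction (∥-unique (∥-sym x∥z) z∥y) (⊏⇒≉ x⊏y)

  -- The two products are x and y in some order, and elements on the same side of `1#` would
  -- commute.
  ∥⇒products-split : ∀ {x y} → x ∥ y →
                     ¬ (x ∙ y ≤ 1# × y ∙ x ≤ 1#) × ¬ (1# ≤ x ∙ y × 1# ≤ y ∙ x)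
  ∥⇒products-split {x} {y} x∥y with ∥-absorption x∥y
  ... | left-zero xy≈x yx≈y =
      (λ (p , q) → x∥y (negative-comm (≤-respˡ-≈ xy≈x p) (≤-respˡ-≈ yx≈y q)))
    , (λ (p , q) → x∥y (positive-comm (≤-respʳ-≈ xy≈x p) (≤-respʳ-≈ yx≈y q)))
  ... | right-zero xy≈y yx≈x =
      (λ (p , q) → x∥y (negative-comm (≤-respˡ-≈ yx≈x q) (≤-respˡ-≈ xy≈y p)))
    , (λ (p , q) → x∥y (positive-comm (≤-respʳ-≈ yx≈x q) (≤-respʳ-≈ xy≈y p)))

  -- Exactly one product is at most `1#`. If it is `y ∙ x`, then `y ≤ x ˡ`; were `x ˡ` equal to
  -- `x ⋆`, both products would be at most `1#`. So `x ˡ` is a partner of x, and partners are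
  -- unique. The other case is symmetric.
  ∥⇒divisor : ∀ {x y} → x ∥ y → x ˡ ≈ y ⊎ x ʳ ≈ y
  ∥⇒divisor {x} {y} x∥y with total (x ∙ y) 1# | total (y ∙ x) 1#
  ... | inj₂ p | inj₂ q = contradiction (p , q) (proj₂ (∥⇒products-split x∥y))
  ... | _      | inj₁ q with ˡ-sel x
  ...   | inj₂ x∥xˡ  = inj₁ (∥-unique x∥xˡ x∥y)
  ...   | inj₁ x⋆≈xˡ = contradiction
    (swap (≤⋆⇒∙≤1 (≤-respʳ-≈ (≈-sym x⋆≈xˡ) (from (//-residual _ _ _) q))))
    (proj₁ (∥⇒products-split x∥y))
  ∥⇒divisor {x} {y} x∥y | inj₁ p | inj₂ _ with ʳ-sel x
  ...   | inj₂ x∥xʳ  = inj₂ (∥-unique x∥xʳ x∥y)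
  ...   | inj₁ x⋆≈xʳ = contradiction
    (swap (≤⋆⇒∙≤1 (≤-respʳ-≈ (≈-sym x⋆≈xʳ) (from (\\-residual _ _ _) p))))
    (proj₁ (∥⇒products-split x∥y))

  -- From `x ⊏ y` follow `x ≤ y ⋆` and `y ≤ x ⋆`. If the second were strict, `x ⋆` would lie
  -- strictly between x and y in `⊏`; if the first were, `y ⋆` would. This recovers `⋆` from the
  -- preorder and the signs, without assuming involutivity.
  cover⇒⋆ : ∀ {x y} → Negative x → Positive y → x ⊏ y →
            (∀ {z} → x ⊏ z → ¬ z ⊏ y) → x ⋆ ≈ y × y ⋆ ≈ x
  cover⇒⋆ {x} {y} x⁻@(x≤1 , _) y⁺@(1≤y , y≉1) x⊏y covers = x⋆≈y , y⋆≈x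
    where
    x≤y⋆ = ⊏⇒≤⋆ x≤1 x⊏y
    y≤x⋆ = ⋆-galois x≤y⋆

    x⋆⁺ : Positive (x ⋆)
    x⋆⁺ = 1≤negative⋆ x≤1 , λ x⋆≈1 → y≉1 (antisym (≤-respʳ-≈ x⋆≈1 y≤x⋆) 1≤y)

    x⋆≈y : x ⋆ ≈ y
    x⋆≈y with y ≈? x ⋆
    ... | yes y≈x⋆ = ≈-sym y≈x⋆
    ... | no y≉x⋆  = contradiction (positive-⊏ 1≤y y≤x⋆ y≉x⋆)
                                   (covers (≤⋆⇒⊏ x⁻ x⋆⁺ (⋆-galois ≤-refl)))

    y⋆≈x : y ⋆ ≈ x
    y⋆≈x with x ≈? y ⋆
    ... | yes x≈y⋆ = ≈-sym x≈y⋆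
    ... | no x≉y⋆  = contradiction (⋆⊏ y⁺)
                       (covers (negative-⊏ (proj₁ (positive-⋆ y⁺)) x≤y⋆ x≉y⋆))

  ⟨⟩-elim : ∀ {t x} (T : Pred Carrier t) → T Respects _≈_ → T x →
            (∀ {y} → T y → T (y ⋆)) → (∀ {y z} → T y → y ∥ z → T z) →
            ∀ {y} → y ∈ ⟨ x ⟩ → T y
  ⟨⟩-elim T resp-T base-T ⋆-T ∥-T = elim
    where
    elim : ∀ {y} → y ∈ ⟨ _ ⟩ → T y
    elim base           = base-T
    elim (left {y} y∈)  = [ (λ p → resp-T p (⋆-T (elim y∈))) , ∥-T (elim y∈) ]′ (ˡ-sel y)
    elim (right {y} y∈) = [ (λ p → resp-T p (⋆-T (elim y∈))) , ∥-T (elim y∈) ]′ (ʳ-sel y)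
    elim (resp y≈z y∈)  = resp-T y≈z (elim y∈)

  ⟨⟩-⋆ : ∀ {x y} → y ∈ ⟨ x ⟩ → y ⋆ ∈ ⟨ x ⟩
  ⟨⟩-⋆ {_} {y} y∈ =
    [ (λ p → resp (≈-sym p) (left y∈)) , (λ p → resp (≈-sym p) (right y∈)) ]′ (⋆-sel y)

  ⟨⟩-∥ : ∀ {x y z} → y ∈ ⟨ x ⟩ → y ∥ z → z ∈ ⟨ x ⟩
  ⟨⟩-∥ y∈ y∥z = [ (λ p → resp p (left y∈)) , (λ p → resp p (right y∈)) ]′ (∥⇒divisor y∥z)

  ⟨1⟩ : ∀ {x y} → x ≈ 1# → y ∈ ⟨ x ⟩ → y ≈ 1#
  ⟨1⟩ x≈1 = ⟨⟩-elim (_≈ 1#) (λ x≈y x≈1 → ≈-trans (≈-sym x≈y) x≈1) x≈1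
    (λ y≈1 → ≈-trans (⋆-cong y≈1) 1⋆≈1) (λ y≈1 y∥z → contradiction y∥z (1∦ y≈1))

  -- Every operation returns one of its arguments or an `ʳ` or `ˡ` of one, and these send `1#` to
  -- itself.
  Sg⊆⟨⟩∪1 : ∀ {g x} → x ∈ Sg g → x ∈ ⟨ g ⟩ ⊎ x ≈ 1#
  Sg⊆⟨⟩∪1 {g} = closure
    where
    T : Pred Carrier _
    T x = x ∈ ⟨ g ⟩ ⊎ x ≈ 1#

    resp-T : ∀ {x y} → y ≈ x → T x → T y
    resp-T y≈x (inj₁ x∈)  = inj₁ (resp (≈-sym y≈x) x∈)
    resp-T y≈x (inj₂ x≈1) = inj₂ (≈-trans y≈x x≈1)

    either : ∀ {x y z} → T x → T y → z ≈ x ⊎ z ≈ y → T z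
    either x∈ y∈ = [ (λ p → resp-T p x∈) , (λ p → resp-T p y∈) ]′

    ʳ-T : ∀ {x} → T x → T (x ʳ)
    ʳ-T (inj₁ x∈) = inj₁ (right x∈)
    ʳ-T {x} (inj₂ x≈1) with ʳ-sel x
    ... | inj₁ x⋆≈xʳ = inj₂ (≈-trans (≈-sym x⋆≈xʳ) (≈-trans (⋆-cong x≈1) 1⋆≈1))
    ... | inj₂ x∥xʳ  = contradiction x∥xʳ (1∦ x≈1)

    ˡ-T : ∀ {x} → T x → T (x ˡ)
    ˡ-T (inj₁ x∈) = inj₁ (left x∈)
    ˡ-T {x} (inj₂ x≈1) with ˡ-sel x
    ... | inj₁ x⋆≈xˡ = inj₂ (≈-trans (≈-sym x⋆≈xˡ) (≈-trans (⋆-cong x≈1) 1⋆≈1))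
    ... | inj₂ x∥xˡ  = contradiction x∥xˡ (1∦ x≈1)

    closure : ∀ {x} → x ∈ Sg g → T x
    closure gen  = inj₁ base
    closure unit = inj₂ ≈-refl
    closure (meet {x} {y} x∈ y∈) = either (closure x∈) (closure y∈)
      (Sum.map (λ x≤y → antisym (x∧y≤x x y) (∧-greatest ≤-refl x≤y))
               (λ y≤x → antisym (x∧y≤y x y) (∧-greatest y≤x ≤-refl)) (total x y))
    closure (join {x} {y} x∈ y∈) = either (closure x∈) (closure y∈)
      (Sum.swap (Sum.map (λ x≤y → antisym (∨-least x≤y ≤-refl) (y≤x∨y x y))
               (λ y≤x → antisym (∨-least ≤-refl y≤x) (x≤x∨y x y)) (total x y)))
    closure (mult {x} {y} x∈ y∈) = either (closure x∈) (closure y∈) (∙-sel x y)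
    closure (ldiv {x} {y} x∈ y∈) = either (ʳ-T (closure x∈)) (closure y∈) (\\-sel x y)
    closure (rdiv {x} {y} x∈ y∈) =
      either (ˡ-T (closure y∈)) (closure x∈) (Chain.\\-sel (opposite A) y x)
    closure (resp x≈y x∈) = resp-T (≈-sym x≈y) (closure x∈)

  -- Layer-convexity of generated sets

  module _ (involutive : ⋆-Involutive) where

    negative-⋆ : ∀ {x} → Negative x → Positive (x ⋆)
    negative-⋆ {x} (x≤1 , x≉1) = 1≤negative⋆ x≤1 ,
      λ x⋆≈1 → x≉1 (≈-trans (≈-sym (involutive x)) (≈-trans (⋆-cong x⋆≈1) 1⋆≈1))

    ⊏⋆ : ∀ {x} → Negative x → x ⊏ x ⋆
    ⊏⋆ {x} x⁻ = ⊏-respˡ-≈ (involutive x) (⋆⊏ (negative-⋆ x⁻))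

    -- A positive z with `x ⊏ z` satisfies `z ≤ x ⋆`, which puts `x ⋆` back `⊑`-below z. A negative
    -- z with `z ⊏ x ⋆` satisfies `z ≤ (x ⋆) ⋆`, that is `z ≤ x`, which puts z back `⊑`-below x.
    ⋆-covers : ∀ {x z} → Negative x → x ⊏ z → ¬ z ⊏ x ⋆
    ⋆-covers {x} {z} (x≤1 , x≉1) x⊏z@(_ , z⋢x) z⊏x⋆@(_ , x⋆⋢z) with sign (⊏⇒≉1 z⊏x⋆)
    ... | inj₁ (1≤z , _) =
      x⋆⋢z (proj₂ (positive-∙ 1≤z (⋆-galois (⊏⇒≤⋆ x≤1 x⊏z))))
    ... | inj₂ (z≤1 , _) =
      z⋢x (proj₁ (negative-∙ x≤1 (≤-respʳ-≈ (involutive x) (⊏⇒≤⋆ z≤1 z⊏x⋆))))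

    ≉1-⋆ : ∀ {x} → ¬ x ≈ 1# → ¬ x ⋆ ≈ 1#
    ≉1-⋆ x≉1 = [ proj₂ ∘ positive-⋆ , proj₂ ∘ negative-⋆ ]′ (sign x≉1)

    ⋆-no-crossing-⊏ : ∀ {x p} → ¬ x ≈ 1# → x ⊏ p → ¬ p ⊏ x ⋆
    ⋆-no-crossing-⊏ x≉1 x⊏p p⊏x⋆ with sign x≉1
    ... | inj₁ x⁺ = ⊏-asym (⋆⊏ x⁺) (⊏-trans x⊏p p⊏x⋆)
    ... | inj₂ x⁻ = ⋆-covers x⁻ x⊏p p⊏x⋆

    ⋆-no-crossing-⊐ : ∀ {x p} → ¬ x ≈ 1# → p ⊏ x → ¬ x ⋆ ⊏ p
    ⋆-no-crossing-⊐ {x} x≉1 p⊏x x⋆⊏p with sign x≉1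
    ... | inj₁ x⁺ = ⋆-covers (positive-⋆ x⁺) x⋆⊏p (⊏-respʳ-≈ (≈-sym (involutive x)) p⊏x)
    ... | inj₂ x⁻ = ⊏-asym (⊏⋆ x⁻) (⊏-trans x⋆⊏p p⊏x)

    -- If p is missing, each element of `⟨ x ⟩` is strictly comparable with p, since an equal
    -- element or a partner would bring p in. Neither `⋆` nor partnership crosses p, so all of
    -- `⟨ x ⟩` lies on the side of x, although `q₁` and `q₂` lie on different sides.
    ⟨⟩-layerConvex : ∀ x → ¬ x ≈ 1# → LayerConvex ⟨ x ⟩
    ⟨⟩-layerConvex x x≉1 {q₁} {q₂} {p} q₁∈ q₂∈ q₁≤p p≤q₂ with decide ℓ₂ em (p ∈ ⟨ x ⟩)
    ... | yes p∈ = p∈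
    ... | no p∉  = ⊥-elim ([ (λ x⊏p → ⊏-asym (below-p x⊏p q₂∈) p⊏q₂)
                           , (λ p⊏x → ⊏-asym (above-p p⊏x q₁∈) q₁⊏p) ]′ (apart base))
      where
      apart : ∀ {y} → y ∈ ⟨ x ⟩ → y ⊏ p ⊎ p ⊏ y
      apart {y} y∈ with compare y p
      ... | below y⊏p      = inj₁ y⊏p
      ... | above p⊏y      = inj₂ p⊏y
      ... | equal y≈p      = contradiction (resp y≈p y∈) p∉
      ... | noncommute y∥p = contradiction (⟨⟩-∥ y∈ y∥p) p∉

      q₁⊏p : q₁ ⊏ p
      q₁⊏p with ≤ᴸ-cases q₁≤p
      ... | inj₁ q₁⊏p        = q₁⊏p
      ... | inj₂ (inj₁ q₁≈p) = contradiction (resp q₁≈p q₁∈) p∉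
      ... | inj₂ (inj₂ q₁∥p) = contradiction (⟨⟩-∥ q₁∈ q₁∥p) p∉

      p⊏q₂ : p ⊏ q₂
      p⊏q₂ with ≤ᴸ-cases p≤q₂
      ... | inj₁ p⊏q₂        = p⊏q₂
      ... | inj₂ (inj₁ p≈q₂) = contradiction (resp (≈-sym p≈q₂) q₂∈) p∉
      ... | inj₂ (inj₂ p∥q₂) = contradiction (⟨⟩-∥ q₂∈ (∥-sym p∥q₂)) p∉

      below-p : x ⊏ p → ∀ {y} → y ∈ ⟨ x ⟩ → y ⊏ p
      below-p x⊏p = proj₂ ∘ ⟨⟩-elim (λ y → y ∈ ⟨ x ⟩ × y ⊏ p)
        (λ y≈z (y∈ , y⊏p) → resp y≈z y∈ , ⊏-respˡ-≈ y≈z y⊏p)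
        (base , x⊏p)
        (λ (y∈ , y⊏p) → ⟨⟩-⋆ y∈ ,
          [ id , (λ p⊏y⋆ → contradiction p⊏y⋆ (⋆-no-crossing-⊏ (⊏⇒≉1 y⊏p) y⊏p)) ]′
            (apart (⟨⟩-⋆ y∈)))
        (λ (y∈ , y⊏p) y∥z → ⟨⟩-∥ y∈ y∥z , ⊏-respˡ-∥ y⊏p y∥z)

      above-p : p ⊏ x → ∀ {y} → y ∈ ⟨ x ⟩ → p ⊏ y
      -- `1#` is `⊏`-above all other elements, so, unlike in `below-p`, distinctness from `1#` does
      -- not follow from the position of y and is carried along.
      above-p p⊏x = proj₂ ∘ proj₂ ∘ ⟨⟩-elim (λ y → y ∈ ⟨ x ⟩ × ¬ y ≈ 1# × p ⊏ y)
        (λ y≈z (y∈ , y≉1 , p⊏y) →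
          resp y≈z y∈ , (λ z≈1 → y≉1 (≈-trans y≈z z≈1)) , ⊏-respʳ-≈ y≈z p⊏y)
        (base , x≉1 , p⊏x)
        (λ (y∈ , y≉1 , p⊏y) → ⟨⟩-⋆ y∈ , ≉1-⋆ y≉1 ,
          [ (λ y⋆⊏p → contradiction y⋆⊏p (⋆-no-crossing-⊐ y≉1 p⊏y)) , id ]′ (apart (⟨⟩-⋆ y∈)))
        (λ (y∈ , y≉1 , p⊏y) y∥z →
          ⟨⟩-∥ y∈ y∥z , (λ z≈1 → 1∦ z≈1 (∥-sym y∥z)) , ⊏-respʳ-∥ p⊏y y∥z)

-- From crowns to one-generated ⋆-involutive chains

module _ (P : EP) where
  open EP P
  open Layers P

  -- The rank is the number of the layer. Symmetry of `⊑` within a rank holds for `𝟐ᴸ` and `𝟐ᴿ`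
  -- alike, and suffices to read `⊏` off the ranks.
  record Ranking : Set where
    field
      rank      : Carrier → ℤ
      rank-<    : ∀ {x y} → rank x ℤ.< rank y → x ⊏ y
      rank-≡    : ∀ {x y} → rank x ≡ rank y → x ⊑ y → y ⊑ x

    ⊏⇒rank-< : ∀ {x y} → x ⊏ y → rank x ℤ.< rank y
    ⊏⇒rank-< {x} {y} (x⊑y , y⋢x) with ℤ.<-cmp (rank x) (rank y)
    ... | tri< p _ _ = p
    ... | tri≈ _ p _ = contradiction (rank-≡ p x⊑y) y⋢x
    ... | tri> _ _ p = contradiction x⊑y (proj₂ (rank-< p))

    infix 4 _⋖_

    -- The pairs that `⋆` will exchange: no integer separates consecutive ranks, so these are covers
    -- in `⊏`.
    _⋖_ : Carrier → Carrier → Set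
    x ⋖ y = x ∈ P⁻ × y ∈ P⁺ × rank y ≡ ℤ.suc (rank x)

    ⋖⇒⊏ : ∀ {x y} → x ⋖ y → x ⊏ y
    ⋖⇒⊏ (_ , _ , eq) = rank-< (ℤ.suc[i]≤j⇒i<j (ℤ.≤-reflexive (≡.sym eq)))

    ⋖⇒covers : ∀ {x y z} → x ⋖ y → x ⊏ z → ¬ z ⊏ y
    ⋖⇒covers {x} {y} {z} (_ , _ , eq) x⊏z z⊏y = ℤ.<-irrefl ≡.refl
      (ℤ.≤-<-trans (ℤ.i<j⇒suc[i]≤j (⊏⇒rank-< x⊏z)) (≡.subst (rank z ℤ.<_) eq (⊏⇒rank-< z⊏y)))

    -- The counterpart of `⟨ x ⟩` inside a crown: `up` and `down` become `⋆`, and `twin` becomes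
    -- partnership or equality.
    data Linked (x : Carrier) : Carrier → Set where
      start : Linked x x
      twin  : ∀ {y z} → rank y ≡ rank z → Linked x y → Linked x z
      up    : ∀ {y z} → y ⋖ z → Linked x y → Linked x z
      down  : ∀ {y z} → z ⋖ y → Linked x y → Linked x z

  -- `ascend` and `descend` put every element into an exchanged pair, which yields involutivity;
  -- `connected` yields a single generator, `origin`.
  record Ladder : Set where
    field
      ranking : Ranking
    open Ranking ranking public
    field
      ascend    : ∀ x → x ∈ P⁻ → ∃ λ y → x ⋖ y
      descend   : ∀ y → y ∈ P⁺ → ∃ λ x → x ⋖ y
      origin    : Carrier
      connected : ∀ x → Linked origin x

open Ranking using (rank; start; twin; up; down)

-- Ladders of the four crowns

𝟏ᴸ-ranking : ℤ → Ranking 𝟏ᴸ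
𝟏ᴸ-ranking k = record
  { rank   = λ _ → k
  ; rank-< = λ k<k → contradiction k<k (ℤ.<-irrefl ≡.refl)
  ; rank-≡ = λ _ → ≡.sym
  }

𝟏ᴿ-ranking : ℤ → Ranking 𝟏ᴿ
𝟏ᴿ-ranking k = record
  { rank   = λ _ → k
  ; rank-< = λ k<k → contradiction k<k (ℤ.<-irrefl ≡.refl)
  ; rank-≡ = λ _ → ≡.sym
  }

⊕-ranking : ∀ {P Q} (R : Ranking P) (S : Ranking Q) →
            (∀ x y → rank R x ℤ.< rank S y) → Ranking (P ⊕ Q)
⊕-ranking {P} {Q} R S R<S = record
  { rank   = [ rank R , rank S ]′
  ; rank-< = λ {x} {y} → rank-< {x} {y}
  ; rank-≡ = λ {x} {y} → rank-≡ {x} {y}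
  }
  where
  open Layers (P ⊕ Q)
  rank-< : ∀ {x y} → [ rank R , rank S ]′ x ℤ.< [ rank R , rank S ]′ y → x ⊏ y
  rank-< {inj₁ x} {inj₁ y} p =
    let x⊑y , y⋢x = Ranking.rank-< R p in ₁∼₁ x⊑y , λ { (₁∼₁ q) → y⋢x q }
  rank-< {inj₁ x} {inj₂ y} p = ₁∼₂ , λ ()
  rank-< {inj₂ x} {inj₁ y} p = contradiction (R<S y x) (ℤ.<-asym p)
  rank-< {inj₂ x} {inj₂ y} p =
    let x⊑y , y⋢x = Ranking.rank-< S p in ₂∼₂ x⊑y , λ { (₂∼₂ q) → y⋢x q }

  rank-≡ : ∀ {x y} → [ rank R , rank S ]′ x ≡ [ rank R , rank S ]′ y →
           EP._⊑_ (P ⊕ Q) x y → EP._⊑_ (P ⊕ Q) y x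
  rank-≡ p (₁∼₁ q)         = ₁∼₁ (Ranking.rank-≡ R p q)
  rank-≡ p (₂∼₂ q)         = ₂∼₂ (Ranking.rank-≡ S p q)
  rank-≡ p (₁∼₂ {x} {y})   = contradiction (R<S x y) (ℤ.<-irrefl p)

module _ {I : Set} {_<_ : Rel I 0ℓ} (chain : IsStrictTotalOrder _≡_ _<_) where
  private
    module C = IsStrictTotalOrder chain

  ⨁-ranking : (P : I → EP) → (∀ i {x y} → EP._⊑_ (P i) x y → EP._⊑_ (P i) y x) →
              (ρ : I → ℤ) → (∀ {i j} → i < j → ρ i ℤ.< ρ j) → Ranking (⨁ chain P)
  ⨁-ranking P ⊑-sym ρ ρ-mono = record
    { rank   = λ (i , _) → ρ i
    ; rank-< = rank-<
    ; rank-≡ = rank-≡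
    }
    where
    open Layers (⨁ chain P)
    rank-< : ∀ {x y} → ρ (proj₁ x) ℤ.< ρ (proj₁ y) → x ⊏ y
    rank-< {i , x} {j , y} p with C.compare i j
    ... | tri< i<j i≢j j≮i =
      between i<j , λ { (between j<i) → j≮i j<i ; (within _) → i≢j ≡.refl }
    ... | tri≈ _ ≡.refl _  = contradiction p (ℤ.<-irrefl ≡.refl)
    ... | tri> _ _ j<i     = contradiction (ρ-mono j<i) (ℤ.<-asym p)

    rank-≡ : ∀ {x y} → ρ (proj₁ x) ≡ ρ (proj₁ y) → ⨁-⊑ chain P x y → ⨁-⊑ chain P y x
    rank-≡ p (between i<j)    = contradiction (ρ-mono i<j) (ℤ.<-irrefl p)
    rank-≡ p (within {i} x⊑y) = within (⊑-sym i x⊑y)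

layer : Bool → EP
layer β = if β then 𝟐ᴸ else 𝟐ᴿ

layer-⊑-sym : ∀ β {x y} → EP._⊑_ (layer β) x y → EP._⊑_ (layer β) y x
layer-⊑-sym true  _   = tt
layer-⊑-sym false x≡y = ≡.sym x≡y

positiveOf : ∀ β → ∃ (_∈ EP.P⁺ (layer β))
positiveOf true  = a , ≡.refl
positiveOf false = a , ≡.refl

negativeOf : ∀ β → ∃ (_∈ EP.P⁻ (layer β))
negativeOf true  = b , ≡.refl
negativeOf false = b , ≡.refl

layers-ranking : ∀ {I _<_} (chain : IsStrictTotalOrder {A = I} _≡_ _<_) (L : I → Bool)
                 (ρ : I → ℤ) → (∀ {i j} → i < j → ρ i ℤ.< ρ j) → Ranking (⨁ chain (layers L))
layers-ranking chain L = ⨁-ranking chain (layers L) (λ i → layer-⊑-sym (L i))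

ladder-ℤ : ∀ L → Ladder (body (crown-ℤ L))
ladder-ℤ L = record
  { ranking   = R
  ; ascend    = λ (i , _) x∈ → pos (ℤ.suc i) , x∈ , pos∈ (ℤ.suc i) , ≡.refl
  ; descend   = λ (i , _) y∈ → neg (ℤ.pred i) , neg∈ (ℤ.pred i) , y∈ , ≡.sym (ℤ.suc-pred i)
  ; origin    = pos (+ 0)
  ; connected = λ (i , x) → linked i x
  }
  where
  P = body (crown-ℤ L)

  R : Ranking P
  R = layers-ranking ℤ.<-isStrictTotalOrder L id id
  open Ranking R using (_⋖_; Linked)

  pos neg : ℤ → EP.Carrier P
  pos i = i , proj₁ (positiveOf (L i))
  neg i = i , proj₁ (negativeOf (L i))

  pos∈ : ∀ i → pos i ∈ EP.P⁺ P
  pos∈ i = proj₂ (positiveOf (L i))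

  neg∈ : ∀ i → neg i ∈ EP.P⁻ P
  neg∈ i = proj₂ (negativeOf (L i))

  neg⋖pos : ∀ i → neg i ⋖ pos (ℤ.suc i)
  neg⋖pos i = neg∈ i , pos∈ (ℤ.suc i) , ≡.refl

  linked : ∀ i x → Linked (pos (+ 0)) (i , x)
  linked (+ zero)     x = twin ≡.refl start
  linked (+ suc n)    x = twin ≡.refl (up (neg⋖pos (+ n)) (linked (+ n) _))
  linked -[1+ zero ]  x = twin ≡.refl (down (neg⋖pos -[1+ 0 ]) (linked (+ 0) _))
  linked -[1+ suc n ] x = twin ≡.refl (down (neg⋖pos -[1+ suc n ]) (linked -[1+ n ] _))

ladder-ℕ : ∀ L → Ladder (body (crown-ℕ L))
ladder-ℕ L = record
  { ranking   = R
  ; ascend    = ascend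
  ; descend   = descend
  ; origin    = inj₁ tt
  ; connected = λ where
    (inj₁ tt)      → start
    (inj₂ (i , x)) → linked i x
  }
  where
  P = body (crown-ℕ L)

  R : Ranking P
  -- Rank 0 belongs to the bottom element, so layer i has rank i + 1.
  R = ⊕-ranking (𝟏ᴿ-ranking (+ 0))
        (layers-ranking ℕ.<-isStrictTotalOrder L (λ i → + suc i) (λ i<j → +<+ (s<s i<j)))
        (λ _ _ → +<+ z<s)
  open Ranking R using (_⋖_; Linked)

  pos neg : ℕ → EP.Carrier P
  pos i = inj₂ (i , proj₁ (positiveOf (L i)))
  neg i = inj₂ (i , proj₁ (negativeOf (L i)))

  pos∈ : ∀ i → pos i ∈ EP.P⁺ P
  pos∈ i = proj₂ (positiveOf (L i))

  neg∈ : ∀ i → neg i ∈ EP.P⁻ P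
  neg∈ i = proj₂ (negativeOf (L i))

  ascend : ∀ x → x ∈ EP.P⁻ P → ∃ (x ⋖_)
  ascend (inj₁ tt)      x∈ = pos 0 , x∈ , pos∈ 0 , ≡.refl
  ascend (inj₂ (i , _)) x∈ = pos (suc i) , x∈ , pos∈ (suc i) , ≡.refl

  descend : ∀ y → y ∈ EP.P⁺ P → ∃ (_⋖ y)
  descend (inj₂ (zero  , _)) y∈ = inj₁ tt , tt , y∈ , ≡.refl
  descend (inj₂ (suc i , _)) y∈ = neg i , neg∈ i , y∈ , ≡.refl

  linked : ∀ i x → Linked (inj₁ tt) (inj₂ (i , x))
  linked zero    x = twin {y = pos 0} ≡.refl (up (tt , pos∈ 0 , ≡.refl) start)
  linked (suc i) x = twin {y = pos (suc i)} ≡.refl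
    (up {y = neg i} (neg∈ i , pos∈ (suc i) , ≡.refl) (linked i _))

ladder-ℕ∂ : ∀ L → Ladder (body (crown-ℕ∂ L))
ladder-ℕ∂ L = record
  { ranking   = R
  ; ascend    = ascend
  ; descend   = descend
  ; origin    = inj₂ tt
  ; connected = λ where
    (inj₂ tt)      → start
    (inj₁ (i , x)) → linked i x
  }
  where
  P = body (crown-ℕ∂ L)

  R : Ranking P
  -- Negation undoes the reversal of the order on ℕ; rank 0 is left for the summand `𝟏ᴸ` on top of
  -- the layers.
  R = ⊕-ranking
        (layers-ranking (Flip.isStrictTotalOrder ℕ.<-isStrictTotalOrder) L -[1+_] -<-)
        (𝟏ᴸ-ranking (+ 0)) (λ _ _ → -<+)
  open Ranking R using (_⋖_; Linked)

  pos neg : ℕ → EP.Carrier P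
  pos i = inj₁ (i , proj₁ (positiveOf (L i)))
  neg i = inj₁ (i , proj₁ (negativeOf (L i)))

  pos∈ : ∀ i → pos i ∈ EP.P⁺ P
  pos∈ i = proj₂ (positiveOf (L i))

  neg∈ : ∀ i → neg i ∈ EP.P⁻ P
  neg∈ i = proj₂ (negativeOf (L i))

  ascend : ∀ x → x ∈ EP.P⁻ P → ∃ (x ⋖_)
  ascend (inj₁ (zero  , _)) x∈ = inj₂ tt , x∈ , tt , ≡.refl
  ascend (inj₁ (suc i , _)) x∈ = pos i , x∈ , pos∈ i , ≡.refl

  descend : ∀ y → y ∈ EP.P⁺ P → ∃ (_⋖ y)
  descend (inj₂ tt)      y∈ = neg 0 , neg∈ 0 , y∈ , ≡.refl
  descend (inj₁ (i , _)) y∈ = neg (suc i) , neg∈ (suc i) , y∈ , ≡.refl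

  linked : ∀ i x → Linked (inj₂ tt) (inj₁ (i , x))
  linked zero    x = twin {y = neg 0} ≡.refl (down (neg∈ 0 , tt , ≡.refl) start)
  linked (suc i) x = twin {y = neg (suc i)} ≡.refl
    (down {y = pos i} (neg∈ (suc i) , pos∈ i , ≡.refl) (linked i _))

ladder-Fin : ∀ n L → Ladder (body (crown-Fin n L))
ladder-Fin n L = record
  { ranking   = R
  ; ascend    = ascend
  ; descend   = descend
  ; origin    = inj₁ tt
  ; connected = λ where
    (inj₁ tt)             → start
    (inj₂ (inj₁ (i , x))) →
      twin (proj₂ (proj₂ (negativeAt _ (Fin.toℕ<n i)))) (linked⁻ _ (Fin.toℕ<n i))
    (inj₂ (inj₂ tt))      →
      twin (proj₂ (proj₂ (positiveAt n ℕ.≤-refl))) (linked⁺ n ℕ.≤-refl)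
  }
  where
  P = body (crown-Fin n L)

  R : Ranking P
  R = ⊕-ranking (𝟏ᴿ-ranking (+ 0))
        (⊕-ranking (layers-ranking Fin.<-isStrictTotalOrder L (λ i → + suc (toℕ i))
                                   (λ i<j → +<+ (s<s i<j)))
                   (𝟏ᴸ-ranking (+ suc n))
                   (λ (i , _) _ → +<+ (s<s (Fin.toℕ<n i))))
        (λ { _ (inj₁ _) → +<+ z<s ; _ (inj₂ _) → +<+ z<s })
  open Ranking R using (_⋖_; Linked)

  inner : Fin n → (∀ β → EP.Carrier (layer β)) → EP.Carrier P
  inner i x = inj₂ (inj₁ (i , x (L i)))

  -- The top element serves for `k = n` here and the bottom element for `k = 0` in `negativeAt`, so
  -- the two ends need no separate treatment when links are built. Ranks come as equations because
  -- `toℕ (fromℕ< k<n)` equals k only propositionally.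
  positiveAt : ∀ k → k ℕ.≤ n → ∃ λ x → x ∈ EP.P⁺ P × rank R x ≡ + suc k
  positiveAt k k≤n with ℕ.m≤n⇒m<n∨m≡n k≤n
  ... | inj₁ k<n = inner (fromℕ< k<n) (proj₁ ∘ positiveOf)
                 , proj₂ (positiveOf (L (fromℕ< k<n)))
                 , ≡.cong (λ k → + suc k) (Fin.toℕ-fromℕ< k<n)
  ... | inj₂ ≡.refl = inj₂ (inj₂ tt) , tt , ≡.refl

  negativeAt : ∀ k → k ℕ.≤ n → ∃ λ x → x ∈ EP.P⁻ P × rank R x ≡ + k
  negativeAt zero    _   = inj₁ tt , tt , ≡.refl
  negativeAt (suc k) k<n = inner (fromℕ< k<n) (proj₁ ∘ negativeOf)
                         , proj₂ (negativeOf (L (fromℕ< k<n)))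
                         , ≡.cong (λ k → + suc k) (Fin.toℕ-fromℕ< k<n)

  positive⋗ : ∀ k → k ℕ.≤ n → ∀ x → x ∈ EP.P⁻ P → rank R x ≡ + k → ∃ (x ⋖_)
  positive⋗ k k≤n x x∈ eq with positiveAt k k≤n
  ... | y , y∈ , eq′ = y , x∈ , y∈ , ≡.trans eq′ (≡.cong ℤ.suc (≡.sym eq))

  negative⋖ : ∀ k → k ℕ.≤ n → ∀ y → y ∈ EP.P⁺ P → rank R y ≡ + suc k → ∃ (_⋖ y)
  negative⋖ k k≤n y y∈ eq with negativeAt k k≤n
  ... | x , x∈ , eq′ = x , x∈ , y∈ , ≡.trans eq (≡.cong ℤ.suc (≡.sym eq′))

  ascend : ∀ x → x ∈ EP.P⁻ P → ∃ (x ⋖_)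
  ascend x@(inj₁ tt)             x∈ = positive⋗ 0 z≤n x x∈ ≡.refl
  ascend x@(inj₂ (inj₁ (i , _))) x∈ = positive⋗ (suc (toℕ i)) (Fin.toℕ<n i) x x∈ ≡.refl

  descend : ∀ y → y ∈ EP.P⁺ P → ∃ (_⋖ y)
  descend y@(inj₂ (inj₁ (i , _))) y∈ = negative⋖ (toℕ i) (ℕ.<⇒≤ (Fin.toℕ<n i)) y y∈ ≡.refl
  descend y@(inj₂ (inj₂ tt))      y∈ = negative⋖ n ℕ.≤-refl y y∈ ≡.refl

  linked⁻ : ∀ k k≤n → Linked (inj₁ tt) (proj₁ (negativeAt k k≤n))
  linked⁺ : ∀ k k≤n → Linked (inj₁ tt) (proj₁ (positiveAt k k≤n))
  linked⁻ zero    _   = start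
  linked⁻ (suc k) k<n = twin
    (≡.trans (proj₂ (proj₂ (positiveAt k (ℕ.<⇒≤ k<n))))
             (≡.sym (proj₂ (proj₂ (negativeAt (suc k) k<n)))))
    (linked⁺ k (ℕ.<⇒≤ k<n))
  linked⁺ k k≤n with negativeAt k k≤n | linked⁻ k k≤n | positiveAt k k≤n
  ... | x , x∈ , eq | linked-x | y , y∈ , eq′ =
    up (x∈ , y∈ , ≡.trans eq′ (≡.cong ℤ.suc (≡.sym eq))) linked-x

ladder : ∀ C → Ladder (body C)
ladder (crown-ℤ L)     = ladder-ℤ L
ladder (crown-ℕ L)     = ladder-ℕ L
ladder (crown-ℕ∂ L)    = ladder-ℕ∂ L
ladder (crown-Fin n L) = ladder-Fin n L

-- Involutivity and generation from a ladder

module FromCrown {c ℓ₁ ℓ₂ : Level} (em : ExcludedMiddle (c ⊔ ℓ₁ ⊔ ℓ₂))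
                 (A : IdempotentResiduatedChain c ℓ₁ ℓ₂)
                 (P : EP) (P-ladder : Ladder P)
                 (φ : Isomorphism (withIdentity P) (enhancedMonoidalPreorder A))
                 (φ1≈1 : IdempotentResiduatedChain._≈_ A (Isomorphism.to φ (inj₂ tt))
                                                         (IdempotentResiduatedChain.1# A))
                 where
  open IdempotentResiduatedChain A
  open Chain A
  open ClassicalChain em A
  open Isomorphism φ using (positive; negative; isOrderIsomorphism) renaming (to to f)
  open IsOrderIsomorphism isOrderIsomorphism
  open Ladder P-ladder hiding (rank; start; twin; up; down)

  ⟦_⟧ : EP.Carrier P → Carrier
  ⟦ z ⟧ = f (inj₁ z)

  ⟦⟧≉1 : ∀ z → ¬ ⟦ z ⟧ ≈ 1#
  ⟦⟧≉1 z ⟦z⟧≈1 with injective (≈-trans ⟦z⟧≈1 (≈-sym φ1≈1))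
  ... | ()

  ⟦⟧-positive : ∀ {z} → z ∈ EP.P⁺ P → Positive ⟦ z ⟧
  ⟦⟧-positive {z} z∈ = to (positive _) z∈ , ⟦⟧≉1 z

  ⟦⟧-negative : ∀ {z} → z ∈ EP.P⁻ P → Negative ⟦ z ⟧
  ⟦⟧-negative {z} z∈ = to (negative _) (inj₁ z∈) , ⟦⟧≉1 z

  ⟦⟧-sign : ∀ z → z ∈ EP.P⁺ P ⊎ z ∈ EP.P⁻ P
  ⟦⟧-sign z with total 1# ⟦ z ⟧
  ... | inj₁ 1≤z = inj₁ (from (positive _) 1≤z)
  ... | inj₂ z≤1 with from (negative _) z≤1
  ...   | inj₁ z∈ = inj₂ z∈

  data View (x : Carrier) : Set ℓ₁ where
    is-1  : x ≈ 1# → View x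
    inner : ∀ z → ⟦ z ⟧ ≈ x → View x

  view : ∀ x → View x
  view x with surjective x
  ... | inj₁ z , z≈x  = inner z (z≈x (EP.Eq.refl (withIdentity P)))
  ... | inj₂ tt , 1≈x = is-1 (≈-trans (≈-sym (1≈x (EP.Eq.refl (withIdentity P)))) φ1≈1)

  ⟦⟧-mono : ∀ {x y} → Layers._⊏_ P x y → ⟦ x ⟧ ⊏ ⟦ y ⟧
  ⟦⟧-mono (x⊑y , y⋢x) = mono (₁∼₁ x⊑y) , y⋢x ∘ drop-inj₁ ∘ cancel

  ⟦⟧-cancel : ∀ {x y} → ⟦ x ⟧ ⊏ ⟦ y ⟧ → Layers._⊏_ P x y
  ⟦⟧-cancel (x⊑y , y⋢x) = drop-inj₁ (cancel x⊑y) , y⋢x ∘ mono ∘ ₁∼₁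

  -- Covers in the crown remain covers in the chain: the only element that is not an image is `1#`,
  -- which is `⊏`-below nothing.
  ⋖⇒⋆ : ∀ {x y} → x ⋖ y → ⟦ x ⟧ ⋆ ≈ ⟦ y ⟧ × ⟦ y ⟧ ⋆ ≈ ⟦ x ⟧
  ⋖⇒⋆ {x} {y} x⋖y@(x∈ , y∈ , _) =
    cover⇒⋆ (⟦⟧-negative x∈) (⟦⟧-positive y∈) (⟦⟧-mono (⋖⇒⊏ x⋖y)) covers
    where
    covers : ∀ {z} → ⟦ x ⟧ ⊏ z → ¬ z ⊏ ⟦ y ⟧
    covers {z} x⊏z z⊏y with view z
    ... | is-1 z≈1      = ⊏⇒≉1 z⊏y z≈1
    ... | inner z′ z′≈z = ⋖⇒covers x⋖y (⟦⟧-cancel (⊏-respʳ-≈ (≈-sym z′≈z) x⊏z))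
                                       (⟦⟧-cancel (⊏-respˡ-≈ (≈-sym z′≈z) z⊏y))

  twins : ∀ {x y} → rank ranking x ≡ rank ranking y → ⟦ x ⟧ ≈ ⟦ y ⟧ ⊎ ⟦ x ⟧ ∥ ⟦ y ⟧
  twins {x} {y} eq with compare ⟦ x ⟧ ⟦ y ⟧
  ... | below x⊏y      = contradiction (⊏⇒rank-< (⟦⟧-cancel x⊏y)) (ℤ.<-irrefl eq)
  ... | above y⊏x      = contradiction (⊏⇒rank-< (⟦⟧-cancel y⊏x)) (ℤ.<-irrefl (≡.sym eq))
  ... | equal x≈y      = inj₁ x≈y
  ... | noncommute x∥y = inj₂ x∥y

  involutive : ⋆-Involutive
  involutive x with view x
  ... | is-1 x≈1    = ≈-trans (⋆-cong (≈-trans (⋆-cong x≈1) 1⋆≈1)) (≈-trans 1⋆≈1 (≈-sym x≈1))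
  ... | inner z z≈x = ≈-trans (≈-sym (⋆-cong (⋆-cong z≈x))) (≈-trans z⋆⋆≈z z≈x)
    where
    z⋆⋆≈z : (⟦ z ⟧ ⋆) ⋆ ≈ ⟦ z ⟧
    z⋆⋆≈z with ⟦⟧-sign z
    ... | inj₁ z∈ = let p , q = ⋖⇒⋆ (proj₂ (descend z z∈)) in ≈-trans (⋆-cong q) p
    ... | inj₂ z∈ = let p , q = ⋖⇒⋆ (proj₂ (ascend z z∈)) in ≈-trans (⋆-cong p) q

  linked⇒⟨⟩ : ∀ {x y} → Linked x y → ⟦ y ⟧ ∈ ⟨ ⟦ x ⟧ ⟩
  linked⇒⟨⟩ start        = base
  linked⇒⟨⟩ (twin eq l)  = [ (λ p → resp p (linked⇒⟨⟩ l)) , ⟨⟩-∥ (linked⇒⟨⟩ l) ]′ (twins eq)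
  linked⇒⟨⟩ (up y⋖z l)   = resp (proj₁ (⋖⇒⋆ y⋖z)) (⟨⟩-⋆ (linked⇒⟨⟩ l))
  linked⇒⟨⟩ (down z⋖y l) = resp (proj₂ (⋖⇒⋆ z⋖y)) (⟨⟩-⋆ (linked⇒⟨⟩ l))

  oneGenerated : OneGenerated
  oneGenerated = ⟦ origin ⟧ , generates
    where
    generates : ∀ x → x ∈ Sg ⟦ origin ⟧
    generates x with view x
    ... | is-1 x≈1    = resp (≈-sym x≈1) unit
    ... | inner z z≈x = resp z≈x (⟨⟩⊆Sg (linked⇒⟨⟩ (connected z)))

-- From one-generated ⋆-involutive chains to crowns

module Embeddings {c ℓ₁ ℓ₂ : Level} (A : IdempotentResiduatedChain c ℓ₁ ℓ₂) where
  open IdempotentResiduatedChain A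
  open Chain A

  -- An isomorphism short of surjectivity and of the identity element, so that it can be glued along
  -- ordinal sums. Strict signs keep the image away from `1#`; with `signed` they also make signs
  -- reflect back to P.
  record Embedding (P : EP) : Set (c ⊔ ℓ₁ ⊔ ℓ₂) where
    open EP P using (P⁺; P⁻) renaming (_≈_ to _≈ᴾ_; _⊑_ to _⊑ᴾ_)
    field
      ⟦_⟧       : EP.Carrier P → Carrier
      cong      : ∀ {x y} → x ≈ᴾ y → ⟦ x ⟧ ≈ ⟦ y ⟧
      injective : ∀ {x y} → ⟦ x ⟧ ≈ ⟦ y ⟧ → x ≈ᴾ y
      mono      : ∀ {x y} → x ⊑ᴾ y → ⟦ x ⟧ ⊑ ⟦ y ⟧
      cancel    : ∀ {x y} → ⟦ x ⟧ ⊑ ⟦ y ⟧ → x ⊑ᴾ y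
      positive  : ∀ {x} → x ∈ P⁺ → Positive ⟦ x ⟧
      negative  : ∀ {x} → x ∈ P⁻ → Negative ⟦ x ⟧
      signed    : ∀ x → x ∈ P⁺ ⊎ x ∈ P⁻

    Image : Pred Carrier ℓ₁
    Image x = ∃ λ z → ⟦ z ⟧ ≈ x

    ⟦⟧≉1 : ∀ z → ¬ ⟦ z ⟧ ≈ 1#
    ⟦⟧≉1 z = [ proj₂ ∘ positive , proj₂ ∘ negative ]′ (signed z)

    positive⁻¹ : ∀ z → 1# ≤ ⟦ z ⟧ → z ∈ P⁺
    positive⁻¹ z 1≤z with signed z
    ... | inj₁ z∈ = z∈
    ... | inj₂ z∈ = let z≤1 , z≉1 = negative z∈ in contradiction (antisym z≤1 1≤z) z≉1

    negative⁻¹ : ∀ z → ⟦ z ⟧ ≤ 1# → z ∈ P⁻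
    negative⁻¹ z z≤1 with signed z
    ... | inj₁ z∈ = let 1≤z , z≉1 = positive z∈ in contradiction (antisym z≤1 1≤z) z≉1
    ... | inj₂ z∈ = z∈

    toIsomorphism : (∀ x → x ≈ 1# ⊎ x ∈ Image) →
                    Isomorphism (withIdentity P) (enhancedMonoidalPreorder A)
    toIsomorphism covers = record
      { to                 = f
      ; isOrderIsomorphism = record
        { isOrderMonomorphism = record
          { isOrderHomomorphism = record { cong = f-cong ; mono = f-mono }
          ; injective = f-injective
          ; cancel    = f-cancel
          }
        ; surjective = λ x → f-surjective (covers x)
        }
      ; positive = λ where
          (inj₁ z)  → mk⇔ (proj₁ ∘ positive) (positive⁻¹ z)
          (inj₂ tt) → mk⇔ (λ _ → ≤-refl) (λ _ → tt)
      ; negative = λ where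
          (inj₁ z)  → mk⇔ (λ { (inj₁ z∈) → proj₁ (negative z∈) }) (inj₁ ∘ negative⁻¹ z)
          (inj₂ tt) → mk⇔ (λ _ → ≤-refl) (λ _ → inj₂ (inj₂ ≡.refl))
      }
      where
      module W = EP (withIdentity P)

      f : W.Carrier → Carrier
      f = [ ⟦_⟧ , (λ _ → 1#) ]′

      f-cong : ∀ {x y} → x W.≈ y → f x ≈ f y
      f-cong (inj₁ p) = cong p
      f-cong (inj₂ _) = ≈-refl

      f-mono : ∀ {x y} → x W.⊑ y → f x ⊑ f y
      f-mono (₁∼₁ p) = mono p
      f-mono ₁∼₂     = identityʳ _
      f-mono (₂∼₂ _) = identityʳ _

      f-injective : ∀ {x y} → f x ≈ f y → x W.≈ y
      f-injective {inj₁ x} {inj₁ y} p = inj₁ (injective p)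
      f-injective {inj₁ x} {inj₂ _} p = contradiction p (⟦⟧≉1 x)
      f-injective {inj₂ _} {inj₁ y} p = contradiction (≈-sym p) (⟦⟧≉1 y)
      f-injective {inj₂ _} {inj₂ _} p = inj₂ ≡.refl

      f-cancel : ∀ {x y} → f x ⊑ f y → x W.⊑ y
      f-cancel {inj₁ x} {inj₁ y} p = ₁∼₁ (cancel p)
      f-cancel {inj₁ x} {inj₂ _} p = ₁∼₂
      f-cancel {inj₂ _} {inj₁ y} p = contradiction (≈-trans (≈-sym (identityˡ _)) p) (⟦⟧≉1 y)
      f-cancel {inj₂ _} {inj₂ _} p = ₂∼₂ ≡.refl

      f-surjective : ∀ {x} → x ≈ 1# ⊎ x ∈ Image → ∃ λ z → ∀ {w} → w W.≈ z → f w ≈ x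
      f-surjective (inj₁ x≈1)       = inj₂ tt , λ w≈ → ≈-trans (f-cong w≈) (≈-sym x≈1)
      f-surjective (inj₂ (z , z≈x)) = inj₁ z , λ w≈ → ≈-trans (f-cong w≈) z≈x

  open Embedding

  𝟏ᴸ-embedding : ∀ {x} → Positive x → Embedding 𝟏ᴸ
  𝟏ᴸ-embedding {x} x⁺ = record
    { ⟦_⟧       = λ _ → x
    ; cong      = λ _ → ≈-refl
    ; injective = λ _ → ≡.refl
    ; mono      = λ _ → idem x
    ; cancel    = λ _ → ≡.refl
    ; positive  = λ _ → x⁺
    ; negative  = λ ()
    ; signed    = λ _ → inj₁ tt
    }

  𝟏ᴿ-embedding : ∀ {x} → Negative x → Embedding 𝟏ᴿ
  𝟏ᴿ-embedding {x} x⁻ = record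
    { ⟦_⟧       = λ _ → x
    ; cong      = λ _ → ≈-refl
    ; injective = λ _ → ≡.refl
    ; mono      = λ _ → idem x
    ; cancel    = λ _ → ≡.refl
    ; positive  = λ ()
    ; negative  = λ _ → x⁻
    ; signed    = λ _ → inj₂ tt
    }

  module _ {x y : Carrier} (x⁺ : Positive x) (y⁻ : Negative y) (x∥y : x ∥ y) where

    private
      choose : Two → Carrier
      choose a = x
      choose b = y

      choose-injective : ∀ {u v} → choose u ≈ choose v → u ≡ v
      choose-injective {a} {a} _ = ≡.refl
      choose-injective {a} {b} p = contradiction p (∥⇒≉ x∥y)
      choose-injective {b} {a} p = contradiction (≈-sym p) (∥⇒≉ x∥y)
      choose-injective {b} {b} _ = ≡.refl

      choose-sign : ∀ u → u ≡ a ⊎ u ≡ b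
      choose-sign a = inj₁ ≡.refl
      choose-sign b = inj₂ ≡.refl

    -- The decision is an argument so that matching on it also computes the Boolean that selects the
    -- summand.
    layer-embedding : (d : Dec (x ⊑ y)) → Embedding (if does d then 𝟐ᴸ else 𝟐ᴿ)
    layer-embedding (yes x⊑y) = record
      { ⟦_⟧       = choose
      ; cong      = λ { ≡.refl → ≈-refl }
      ; injective = choose-injective
      ; mono      = λ {u} {v} _ → full u v
      ; cancel    = λ _ → tt
      ; positive  = λ { ≡.refl → x⁺ }
      ; negative  = λ { ≡.refl → y⁻ }
      ; signed    = choose-sign
      }
      where
      y⊑x : y ⊑ x
      y⊑x with ∥-absorption x∥y
      ... | left-zero _ yx≈y     = yx≈y
      ... | right-zero xy≈y yx≈x = contradiction (≈-trans (≈-sym x⊑y) xy≈y) (∥⇒≉ x∥y)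

      full : ∀ u v → choose u ⊑ choose v
      full a a = idem x
      full a b = x⊑y
      full b a = y⊑x
      full b b = idem y
    layer-embedding (no x⋢y) = record
      { ⟦_⟧       = choose
      ; cong      = λ { ≡.refl → ≈-refl }
      ; injective = choose-injective
      ; mono      = λ { {u} ≡.refl → idem (choose u) }
      ; cancel    = λ {u} {v} → discrete u v
      ; positive  = λ { ≡.refl → x⁺ }
      ; negative  = λ { ≡.refl → y⁻ }
      ; signed    = choose-sign
      }
      where
      y⋢x : ¬ y ⊑ x
      y⋢x with ∥-absorption x∥y
      ... | left-zero xy≈x _  = contradiction xy≈x x⋢y
      ... | right-zero _ yx≈x = λ yx≈y → ∥⇒≉ x∥y (≈-trans (≈-sym yx≈x) yx≈y)

      discrete : ∀ u v → choose u ⊑ choose v → u ≡ v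
      discrete a a _ = ≡.refl
      discrete a b p = contradiction p x⋢y
      discrete b a p = contradiction p y⋢x
      discrete b b _ = ≡.refl

    layer-⟦⟧ : ∀ d z → ⟦ layer-embedding d ⟧ z ≈ x ⊎ ⟦ layer-embedding d ⟧ z ≈ y
    layer-⟦⟧ (yes _) a = inj₁ ≈-refl
    layer-⟦⟧ (yes _) b = inj₂ ≈-refl
    layer-⟦⟧ (no _)  a = inj₁ ≈-refl
    layer-⟦⟧ (no _)  b = inj₂ ≈-refl

    positive∈layer : ∀ d → x ∈ Image (layer-embedding d)
    positive∈layer (yes _) = a , ≈-refl
    positive∈layer (no _)  = a , ≈-refl

    negative∈layer : ∀ d → y ∈ Image (layer-embedding d)
    negative∈layer (yes _) = b , ≈-refl
    negative∈layer (no _)  = b , ≈-refl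

  ⊕-embedding : ∀ {P Q} (E : Embedding P) (F : Embedding Q) →
                (∀ x y → ⟦ E ⟧ x ⊏ ⟦ F ⟧ y) → Embedding (P ⊕ Q)
  ⊕-embedding {P} {Q} E F E⊏F = record
    { ⟦_⟧       = f
    ; cong      = λ { (inj₁ p) → cong E p ; (inj₂ p) → cong F p }
    ; injective = λ {x} {y} → f-injective x y
    ; mono      = f-mono
    ; cancel    = λ {x} {y} → f-cancel x y
    ; positive  = λ { {inj₁ _} → positive E ; {inj₂ _} → positive F }
    ; negative  = λ { {inj₁ _} → negative E ; {inj₂ _} → negative F }
    ; signed    = λ { (inj₁ x) → signed E x ; (inj₂ y) → signed F y }
    }
    where
    module S = EP (P ⊕ Q)

    f : S.Carrier → Carrier
    f = [ ⟦ E ⟧ , ⟦ F ⟧ ]′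

    f-injective : ∀ x y → f x ≈ f y → x S.≈ y
    f-injective (inj₁ x) (inj₁ y) p = inj₁ (injective E p)
    f-injective (inj₁ x) (inj₂ y) p = contradiction p (⊏⇒≉ (E⊏F x y))
    f-injective (inj₂ x) (inj₁ y) p = contradiction (≈-sym p) (⊏⇒≉ (E⊏F y x))
    f-injective (inj₂ x) (inj₂ y) p = inj₂ (injective F p)

    f-mono : ∀ {x y} → x S.⊑ y → f x ⊑ f y
    f-mono (₁∼₁ p)       = mono E p
    f-mono (₁∼₂ {x} {y}) = proj₁ (E⊏F x y)
    f-mono (₂∼₂ p)       = mono F p

    f-cancel : ∀ x y → f x ⊑ f y → x S.⊑ y
    f-cancel (inj₁ x) (inj₁ y) p = ₁∼₁ (cancel E p)
    f-cancel (inj₁ x) (inj₂ y) p = ₁∼₂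
    f-cancel (inj₂ x) (inj₁ y) p = contradiction p (proj₂ (E⊏F y x))
    f-cancel (inj₂ x) (inj₂ y) p = ₂∼₂ (cancel F p)

  module _ {I : Set} {_<_ : Rel I 0ℓ} (chain : IsStrictTotalOrder _≡_ _<_) {P : I → EP} where
    private
      module C = IsStrictTotalOrder chain

    ⨁-embedding : (E : ∀ i → Embedding (P i)) →
                  (∀ {i j} → i < j → ∀ x y → ⟦ E i ⟧ x ⊏ ⟦ E j ⟧ y) → Embedding (⨁ chain P)
    ⨁-embedding E E-mono = record
      { ⟦_⟧       = f
      ; cong      = λ { (within {i} p) → cong (E i) p }
      ; injective = f-injective
      ; mono      = f-mono
      ; cancel    = f-cancel
      ; positive  = λ { {i , _} → positive (E i) }
      ; negative  = λ { {i , _} → negative (E i) }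
      ; signed    = λ (i , x) → signed (E i) x
      }
      where
      f : Σ I (EP.Carrier ∘ P) → Carrier
      f (i , x) = ⟦ E i ⟧ x

      f-injective : ∀ {x y} → f x ≈ f y → ⨁-≈ chain P x y
      f-injective {i , x} {j , y} p with C.compare i j
      ... | tri< i<j _ _    = contradiction p (⊏⇒≉ (E-mono i<j x y))
      ... | tri≈ _ ≡.refl _ = within (injective (E i) p)
      ... | tri> _ _ j<i    = contradiction (≈-sym p) (⊏⇒≉ (E-mono j<i y x))

      f-mono : ∀ {x y} → ⨁-⊑ chain P x y → f x ⊑ f y
      f-mono (between i<j)  = proj₁ (E-mono i<j _ _)
      f-mono (within {i} p) = mono (E i) p

      f-cancel : ∀ {x y} → f x ⊑ f y → ⨁-⊑ chain P x y
      f-cancel {i , x} {j , y} p with C.compare i j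
      ... | tri< i<j _ _    = between i<j
      ... | tri≈ _ ≡.refl _ = within (cancel (E i) p)
      ... | tri> _ _ j<i    = contradiction p (proj₂ (E-mono j<i y x))

least : ∀ {p} {P : Pred ℕ p} → Decidable P → ∀ n → P n → ∃ λ m → P m × (∀ j → j ℕ.< m → ¬ P j)
least {P = P} P? = <-rec _ search
  where
  search : ∀ n → (∀ {m} → m ℕ.< n → P m → ∃ λ k → P k × (∀ j → j ℕ.< k → ¬ P j)) →
           P n → ∃ λ k → P k × (∀ j → j ℕ.< k → ¬ P j)
  search n rec Pn with ℕ.anyUpTo? P? n
  ... | yes (m , m<n , Pm) = rec m<n Pm
  ... | no none            = n , Pn , λ j j<n Pj → none (j , j<n , Pj)

-- Walks alternating `⋆` and partners

module ToCrown {c ℓ₁ ℓ₂ : Level} (em : ExcludedMiddle (c ⊔ ℓ₁ ⊔ ℓ₂))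
               (A : IdempotentResiduatedChain c ℓ₁ ℓ₂)
               (involutive : IdempotentResiduatedChain.⋆-Involutive A) where
  open IdempotentResiduatedChain A
  open Chain A
  open ClassicalChain em A
  open Embeddings A
  open Embedding

  -- Steps to a partner are reversible, and steps along `⋆` are so by involutivity.
  ⟨⟩-sym : ∀ {x y} → y ∈ ⟨ x ⟩ → x ∈ ⟨ y ⟩
  ⟨⟩-sym {x} = ⟨⟩-elim (λ y → x ∈ ⟨ y ⟩)
    (λ y≈z x∈ → ⟨⟩-trans x∈ (resp (≈-sym y≈z) base))
    base
    (λ {y} x∈ → ⟨⟩-trans x∈ (resp (involutive y) (⟨⟩-⋆ base)))
    (λ x∈ y∥z → ⟨⟩-trans x∈ (⟨⟩-∥ base (∥-sym y∥z)))

  Partnered : Pred Carrier (c ⊔ ℓ₁)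
  Partnered x = ∃ (x ∥_)

  Partnered? : Decidable Partnered
  Partnered? x = decide ℓ₂ em (Partnered x)

  -- Without a partner the value is irrelevant.
  partner : Carrier → Carrier
  partner x with Partnered? x
  ... | yes (y , _) = y
  ... | no _        = x

  partner-∥ : ∀ {x} → Partnered x → x ∥ partner x
  partner-∥ {x} px with Partnered? x
  ... | yes (_ , x∥y) = x∥y
  ... | no ¬px        = contradiction px ¬px

  -- Climbs from a negative x and descends from a positive x.
  walk : Carrier → ℕ → Carrier
  walk x zero    = x
  walk x (suc k) = partner (walk x k ⋆)

  -- `walk` is total, but its k-th value is meaningful only if the partners taken in the first k
  -- steps exist.
  Reaches : Carrier → ℕ → Set (c ⊔ ℓ₁)
  Reaches x k = ∀ j → j ℕ.< k → Partnered (walk x j ⋆)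

  reaches-pred : ∀ {x k} → Reaches x (suc k) → Reaches x k
  reaches-pred r j j<k = r j (ℕ.m<n⇒m<1+n j<k)

  walk-∥ : ∀ {x k} → Reaches x (suc k) → walk x k ⋆ ∥ walk x (suc k)
  walk-∥ r = partner-∥ (r _ ℕ.≤-refl)

  walk-negative : ∀ {x} → Negative x → ∀ k → Reaches x k → Negative (walk x k)
  walk-negative x⁻ zero    r = x⁻
  walk-negative x⁻ (suc k) r =
    ∥-positive (negative-⋆ involutive (walk-negative x⁻ k (reaches-pred r))) (walk-∥ r)

  walk-positive : ∀ {x} → Positive x → ∀ k → Reaches x k → Positive (walk x k)
  walk-positive x⁺ zero    r = x⁺
  walk-positive x⁺ (suc k) r =
    ∥-negative (positive-⋆ (walk-positive x⁺ k (reaches-pred r))) (walk-∥ r)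

  walk-⊏-suc : ∀ {x} → Negative x → ∀ k → Reaches x (suc k) → walk x k ⊏ walk x (suc k)
  walk-⊏-suc x⁻ k r =
    ⊏-respʳ-∥ (⊏⋆ involutive (walk-negative x⁻ k (reaches-pred r))) (walk-∥ r)

  walk-⊐-suc : ∀ {x} → Positive x → ∀ k → Reaches x (suc k) → walk x (suc k) ⊏ walk x k
  walk-⊐-suc x⁺ k r = ⊏-respˡ-∥ (⋆⊏ (walk-positive x⁺ k (reaches-pred r))) (walk-∥ r)

  walk-⊏ : ∀ {x} → Negative x → ∀ {i j} → i ℕ.< j → Reaches x j → walk x i ⊏ walk x j
  walk-⊏ x⁻ {i} {suc j} (s≤s i≤j) r with ℕ.m≤n⇒m<n∨m≡n i≤j
  ... | inj₁ i<j    = ⊏-trans (walk-⊏ x⁻ i<j (reaches-pred r)) (walk-⊏-suc x⁻ j r)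
  ... | inj₂ ≡.refl = walk-⊏-suc x⁻ j r

  walk-⊐ : ∀ {x} → Positive x → ∀ {i j} → i ℕ.< j → Reaches x j → walk x j ⊏ walk x i
  walk-⊐ x⁺ {i} {suc j} (s≤s i≤j) r with ℕ.m≤n⇒m<n∨m≡n i≤j
  ... | inj₁ i<j    = ⊏-trans (walk-⊐-suc x⁺ j r) (walk-⊐ x⁺ i<j (reaches-pred r))
  ... | inj₂ ≡.refl = walk-⊐-suc x⁺ j r

  -- `walk x i ⋆` shares a layer with its partner `walk x (suc i)`, so the descent of the walk
  -- carries over with indices shifted by one.
  walk⋆-⊐ : ∀ {x} → Positive x → ∀ {i j} → i ℕ.< j → Reaches x (suc j) →
            walk x j ⋆ ⊏ walk x i ⋆
  walk⋆-⊐ x⁺ {i} {j} i<j r =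
    ⊏-respˡ-∥ (⊏-respʳ-∥ (walk-⊐ x⁺ (s<s i<j) r)
                         (∥-sym (walk-∥ (λ k k≤i → r k (ℕ.<-≤-trans k≤i (ℕ.<⇒≤ (s<s i<j)))))))
              (∥-sym (walk-∥ r))

  data OnWalk (x y : Carrier) (k : ℕ) : Set ℓ₁ where
    stop : y ≈ walk x k → OnWalk x y k
    star : y ≈ walk x k ⋆ → OnWalk x y k

  Reached : Carrier → Pred Carrier (c ⊔ ℓ₁)
  Reached x y = ∃ λ k → Reaches x k × OnWalk x y k

  reached-resp : ∀ {x} → Reached x Respects _≈_
  reached-resp y≈z (k , r , stop p) = k , r , stop (≈-trans (≈-sym y≈z) p)
  reached-resp y≈z (k , r , star p) = k , r , star (≈-trans (≈-sym y≈z) p)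

  reached-⋆ : ∀ {x y} → Reached x y → Reached x (y ⋆)
  reached-⋆ (k , r , stop p) = k , r , star (⋆-cong p)
  reached-⋆ (k , r , star p) = k , r , stop (≈-trans (⋆-cong p) (involutive _))

  -- Partnership joins `walk x k ⋆` to `walk x (suc k)`, so the start x is the only place where a
  -- partner step can leave the walk.
  reached-∥ : ∀ {x y z} → Reached x y → y ∥ z → y ≈ x ⊎ Reached x z
  reached-∥ (zero  , r , stop p) y∥z = inj₁ p
  reached-∥ (suc k , r , stop p) y∥z =
    inj₂ (k , reaches-pred r , star (∥-unique (∥-respˡ p y∥z) (∥-sym (walk-∥ r))))
  reached-∥ {x} {_} {z} (k , r , star p) y∥z =
    inj₂ (suc k , r′ , stop (∥-unique (∥-respˡ p y∥z) (walk-∥ r′)))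
    where
    r′ : Reaches x (suc k)
    r′ j (s≤s j≤k) with ℕ.m≤n⇒m<n∨m≡n j≤k
    ... | inj₁ j<k    = r j j<k
    -- The given z is itself the partner that the additional step requires.
    ... | inj₂ ≡.refl = z , ∥-respˡ p y∥z

  reached-base : ∀ {x} → Reached x x
  reached-base = 0 , (λ _ ()) , stop ≈-refl

  ⟨⟩⊆reached : ∀ {x y} → ¬ Partnered x → y ∈ ⟨ x ⟩ → Reached x y
  ⟨⟩⊆reached unpartnered = ⟨⟩-elim (Reached _) reached-resp reached-base reached-⋆
    λ y∈ y∥z → [ (λ y≈x → contradiction (_ , ∥-respˡ y≈x y∥z) unpartnered) , id ]′
      (reached-∥ y∈ y∥z)

  -- Leaving either walk at its start means entering the other at its start.
  ⟨⟩⊆reached-∥ : ∀ {x x′ y} → x ∥ x′ → y ∈ ⟨ x ⟩ → Reached x y ⊎ Reached x′ y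
  ⟨⟩⊆reached-∥ {x} {x′} x∥x′ = ⟨⟩-elim (λ y → Reached x y ⊎ Reached x′ y)
    (λ y≈z → Sum.map (reached-resp y≈z) (reached-resp y≈z))
    (inj₁ reached-base)
    (Sum.map reached-⋆ reached-⋆)
    λ where
      (inj₁ y∈) y∥z → [ (λ y≈x → inj₂ (partner-reached x∥x′ y≈x y∥z)) , inj₁ ]′
        (reached-∥ y∈ y∥z)
      (inj₂ y∈) y∥z → [ (λ y≈x′ → inj₁ (partner-reached (∥-sym x∥x′) y≈x′ y∥z)) , inj₂ ]′
        (reached-∥ y∈ y∥z)
    where
    partner-reached : ∀ {u v y z} → u ∥ v → y ≈ u → y ∥ z → Reached v z
    partner-reached u∥v y≈u y∥z = reached-resp (∥-unique u∥v (∥-respˡ y≈u y∥z)) reached-base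

  -- Strict growth is required of negative elements only: each positive element shares the layer of
  -- its partner and inherits the comparisons.
  record PairFamily {I : Set} (_<_ : Rel I 0ℓ) : Set (c ⊔ ℓ₁ ⊔ ℓ₂) where
    field
      pos neg      : I → Carrier
      pos-positive : ∀ i → Positive (pos i)
      neg-negative : ∀ i → Negative (neg i)
      pos∥neg      : ∀ i → pos i ∥ neg i
      neg-mono     : ∀ {i j} → i < j → neg i ⊏ neg j

    pos⊑neg? : ∀ i → Dec (pos i ⊑ neg i)
    pos⊑neg? i = pos i ∙ neg i ≈? pos i

    subset : I → Bool
    subset i = does (pos⊑neg? i)

    module _ (chain : IsStrictTotalOrder _≡_ _<_) where
      private
        E : ∀ i → Embedding (layers subset i)
        E i = layer-embedding (pos-positive i) (neg-negative i) (pos∥neg i) (pos⊑neg? i)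

      layer-image : ∀ i z → ⟦ E i ⟧ z ≈ pos i ⊎ ⟦ E i ⟧ z ≈ neg i
      layer-image i = layer-⟦⟧ (pos-positive i) (neg-negative i) (pos∥neg i) (pos⊑neg? i)

      layer-⊏ : ∀ i z {w} → neg i ⊏ w → ⟦ E i ⟧ z ⊏ w
      layer-⊏ i z n⊏w with layer-image i z
      ... | inj₁ p = ⊏-respˡ-≈ (≈-sym p) (⊏-respˡ-∥ n⊏w (∥-sym (pos∥neg i)))
      ... | inj₂ p = ⊏-respˡ-≈ (≈-sym p) n⊏w

      layer-⊐ : ∀ i z {w} → w ⊏ neg i → w ⊏ ⟦ E i ⟧ z
      layer-⊐ i z w⊏n with layer-image i z
      ... | inj₁ p = ⊏-respʳ-≈ (≈-sym p) (⊏-respʳ-∥ w⊏n (∥-sym (pos∥neg i)))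
      ... | inj₂ p = ⊏-respʳ-≈ (≈-sym p) w⊏n

      embedding : Embedding (⨁ chain (layers subset))
      embedding = ⨁-embedding chain E (λ i<j x y → layer-⊏ _ x (layer-⊐ _ y (neg-mono i<j)))

      pos∈image : ∀ {x} i → x ≈ pos i → x ∈ Image embedding
      pos∈image i x≈p =
        let z , eq = positive∈layer (pos-positive i) (neg-negative i) (pos∥neg i) (pos⊑neg? i)
        in (i , z) , ≈-trans eq (≈-sym x≈p)

      neg∈image : ∀ {x} i → x ≈ neg i → x ∈ Image embedding
      neg∈image i x≈n =
        let z , eq = negative∈layer (pos-positive i) (neg-negative i) (pos∥neg i) (pos⊑neg? i)
        in (i , z) , ≈-trans eq (≈-sym x≈n)

  Generator : Pred Carrier (c ⊔ ℓ₁)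
  Generator g = ∀ x → x ≈ 1# ⊎ x ∈ ⟨ g ⟩

  crownian : ∀ C (E : Embedding (body C)) {g} → Generator g →
             (∀ {x} → x ∈ ⟨ g ⟩ → x ∈ Image E) → Crownian A
  crownian C E isGen ⊆image =
    C , toIsomorphism E (λ x → Sum.map₂ ⊆image (isGen x)) , ≈-refl

  -- The crowns read off from walks

  module _ {o : Carrier} (o⁻ : Negative o) (unpartnered : ¬ Partnered o)
           (isGen : Generator o) where

    crownian-ℕ : (∀ k → Partnered (walk o k ⋆)) → Crownian A
    crownian-ℕ partnered = crownian (crown-ℕ subset) E isGen ⊆image
      where
      reaches : ∀ k → Reaches o k
      reaches k j _ = partnered j

      family : PairFamily ℕ._<_
      family = record
        -- Layer i lies directly above `walk o i`: it consists of the cover given by `⋆` and the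
        -- partner of that cover.
        { pos          = λ i → walk o i ⋆
        ; neg          = λ i → walk o (suc i)
        ; pos-positive = λ i → negative-⋆ involutive (walk-negative o⁻ i (reaches i))
        ; neg-negative = λ i → walk-negative o⁻ (suc i) (reaches (suc i))
        ; pos∥neg      = λ i → walk-∥ (reaches (suc i))
        ; neg-mono     = λ {_} {j} i<j → walk-⊏ o⁻ (s<s i<j) (reaches (suc j))
        }
      open PairFamily family

      chain = ℕ.<-isStrictTotalOrder

      E : Embedding (body (crown-ℕ subset))
      E = ⊕-embedding (𝟏ᴿ-embedding o⁻) (embedding chain)
            (λ _ (i , z) → layer-⊐ chain i z (walk-⊏ o⁻ z<s (reaches (suc i))))

      ⊆image : ∀ {x} → x ∈ ⟨ o ⟩ → x ∈ Image E
      ⊆image x∈ with ⟨⟩⊆reached unpartnered x∈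
      ... | zero  , _ , stop x≈ = inj₁ tt , ≈-sym x≈
      ... | suc k , _ , stop x≈ = let z , eq = neg∈image chain k x≈ in inj₂ z , eq
      ... | k     , _ , star x≈ = let z , eq = pos∈image chain k x≈ in inj₂ z , eq

    crownian-Fin : ∀ n → Reaches o n → ¬ Partnered (walk o n ⋆) → Crownian A
    crownian-Fin n reaches stops = crownian (crown-Fin n subset) E isGen ⊆image
      where
      reaches-≤ : ∀ {k} → k ℕ.≤ n → Reaches o k
      reaches-≤ k≤n j j<k = reaches j (ℕ.<-≤-trans j<k k≤n)

      family : PairFamily (Fin._<_ {n} {n})
      family = record
        { pos          = λ i → walk o (toℕ i) ⋆
        ; neg          = λ i → walk o (suc (toℕ i))
        ; pos-positive = λ i → negative-⋆ involutive
                           (walk-negative o⁻ (toℕ i) (reaches-≤ (ℕ.<⇒≤ (Fin.toℕ<n i))))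
        ; neg-negative = λ i → walk-negative o⁻ (suc (toℕ i)) (reaches-≤ (Fin.toℕ<n i))
        ; pos∥neg      = λ i → walk-∥ (reaches-≤ (Fin.toℕ<n i))
        ; neg-mono     = λ {_} {j} i<j → walk-⊏ o⁻ (s<s i<j) (reaches-≤ (Fin.toℕ<n j))
        }
      open PairFamily family

      chain = Fin.<-isStrictTotalOrder {n}

      end⁻ : Negative (walk o n)
      end⁻ = walk-negative o⁻ n reaches

      walk⊏end⋆ : ∀ {k} → k ℕ.≤ n → walk o k ⊏ walk o n ⋆
      walk⊏end⋆ k≤n with ℕ.m≤n⇒m<n∨m≡n k≤n
      ... | inj₁ k<n    = ⊏-trans (walk-⊏ o⁻ k<n reaches) (⊏⋆ involutive end⁻)
      ... | inj₂ ≡.refl = ⊏⋆ involutive end⁻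

      E : Embedding (body (crown-Fin n subset))
      E = ⊕-embedding (𝟏ᴿ-embedding o⁻)
            (⊕-embedding (embedding chain) (𝟏ᴸ-embedding (negative-⋆ involutive end⁻))
              (λ (i , z) _ → layer-⊏ chain i z (walk⊏end⋆ (Fin.toℕ<n i))))
            λ where
              _ (inj₁ (i , z)) → layer-⊐ chain i z (walk-⊏ o⁻ z<s (reaches-≤ (Fin.toℕ<n i)))
              _ (inj₂ tt)      → walk⊏end⋆ z≤n

      at : ∀ (f : ℕ → Carrier) {x k} (k<n : k ℕ.< n) → x ≈ f k → x ≈ f (toℕ (fromℕ< k<n))
      at f k<n = ≡.subst (λ k → _ ≈ f k) (≡.sym (Fin.toℕ-fromℕ< k<n))

      ⊆image : ∀ {x} → x ∈ ⟨ o ⟩ → x ∈ Image E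
      ⊆image x∈ with ⟨⟩⊆reached unpartnered x∈
      -- Passing beyond index n would need a partner of `walk o n ⋆`.
      ... | k , r , on with ℕ.m≤n⇒m<n∨m≡n (ℕ.≮⇒≥ (λ n<k → stops (r n n<k)))
      ⊆image x∈ | zero  , _ , stop x≈ | _ = inj₁ tt , ≈-sym x≈
      ⊆image x∈ | suc k , r , stop x≈ | k+1≤n =
        let k<n = [ ℕ.<⇒≤ , ℕ.≤-reflexive ]′ k+1≤n
            z , eq = neg∈image chain (fromℕ< k<n) (at (λ k → walk o (suc k)) k<n x≈)
        in inj₂ (inj₁ z) , eq
      ⊆image x∈ | k , _ , star x≈ | inj₁ k<n =
        let z , eq = pos∈image chain (fromℕ< k<n) (at (λ k → walk o k ⋆) k<n x≈)
        in inj₂ (inj₁ z) , eq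
      ⊆image x∈ | _ , _ , star x≈ | inj₂ ≡.refl = inj₂ (inj₂ tt) , ≈-sym x≈

  crownian-ℕ∂ : ∀ {t} → Positive t → ¬ Partnered t → Generator t →
                (∀ k → Partnered (walk t k ⋆)) → Crownian A
  crownian-ℕ∂ {t} t⁺ unpartnered isGen partnered = crownian (crown-ℕ∂ subset) E isGen ⊆image
    where
    reaches : ∀ k → Reaches t k
    reaches k j _ = partnered j

    family : PairFamily (flip ℕ._<_)
    family = record
      -- Layers are counted downwards from t, and a walk from a positive element meets the negative
      -- element of each layer before the positive one.
      { pos          = λ i → walk t (suc i)
      ; neg          = λ i → walk t i ⋆
      ; pos-positive = λ i → walk-positive t⁺ (suc i) (reaches (suc i))
      ; neg-negative = λ i → positive-⋆ (walk-positive t⁺ i (reaches i))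
      ; pos∥neg      = λ i → ∥-sym (walk-∥ (reaches (suc i)))
      ; neg-mono     = λ {i} j<i → walk⋆-⊐ t⁺ j<i (reaches (suc i))
      }
    open PairFamily family

    chain = Flip.isStrictTotalOrder ℕ.<-isStrictTotalOrder

    E : Embedding (body (crown-ℕ∂ subset))
    E = ⊕-embedding (embedding chain) (𝟏ᴸ-embedding t⁺)
          λ (i , z) _ → layer-⊏ chain i z (⊏-respˡ-∥ (walk-⊐ t⁺ z<s (reaches (suc i)))
                                                     (∥-sym (walk-∥ (reaches (suc i)))))

    ⊆image : ∀ {x} → x ∈ ⟨ t ⟩ → x ∈ Image E
    ⊆image x∈ with ⟨⟩⊆reached unpartnered x∈
    ... | zero  , _ , stop x≈ = inj₂ tt , ≈-sym x≈
    ... | suc k , _ , stop x≈ = let z , eq = pos∈image chain k x≈ in inj₁ z , eq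
    ... | k     , _ , star x≈ = let z , eq = neg∈image chain k x≈ in inj₁ z , eq

  -- With every non-identity element partnered, the path has no end to start from and is unrolled in
  -- both directions from one layer.
  crownian-ℤ : ∀ {g} → Negative g → Generator g → (∀ {x} → ¬ x ≈ 1# → Partnered x) → Crownian A
  crownian-ℤ {g} g⁻ isGen partnered = crownian (crown-ℤ subset) (embedding chain) isGen ⊆image
    where
    h = partner g

    g∥h : g ∥ h
    g∥h = partner-∥ (partnered (proj₂ g⁻))

    h⁺ : Positive h
    h⁺ = ∥-negative g⁻ g∥h

    reaches-g : ∀ k → Reaches g k
    reaches-g (suc k) j (s≤s j≤k) = partnered (≉1-⋆ involutive (proj₂ (walk-negative g⁻ j
      (λ i i<j → reaches-g k i (ℕ.<-≤-trans i<j j≤k)))))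

    reaches-h : ∀ k → Reaches h k
    reaches-h (suc k) j (s≤s j≤k) = partnered (≉1-⋆ involutive (proj₂ (walk-positive h⁺ j
      (λ i i<j → reaches-h k i (ℕ.<-≤-trans i<j j≤k)))))

    -- g is the negative element of layer 0 and h its partner; the walk from g
    -- fills the layers above, the walk from h those below.
    p n : ℤ → Carrier
    p (+ zero)  = h
    p (+ suc k) = walk g k ⋆
    p -[1+ k ]  = walk h (suc k)
    n (+ k)     = walk g k
    n -[1+ k ]  = walk h k ⋆

    walk-h⋆⊏g : ∀ k → walk h k ⋆ ⊏ g
    walk-h⋆⊏g k = ⊏-respʳ-∥ (walk-h⋆⊏h k) (∥-sym g∥h)
      where
      walk-h⋆⊏h : ∀ k → walk h k ⋆ ⊏ h
      walk-h⋆⊏h zero    = ⋆⊏ h⁺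
      walk-h⋆⊏h (suc k) = ⊏-trans (⋆⊏ (walk-positive h⁺ (suc k) (reaches-h (suc k))))
                                  (walk-⊐ h⁺ z<s (reaches-h (suc k)))

    n-mono : ∀ {i j} → i ℤ.< j → n i ⊏ n j
    n-mono (-<- {m} j<i)    = walk⋆-⊐ h⁺ j<i (reaches-h (suc m))
    n-mono (-<+ {m} {zero}) = walk-h⋆⊏g m
    n-mono (-<+ {m} {suc k}) = ⊏-trans (walk-h⋆⊏g m) (walk-⊏ g⁻ z<s (reaches-g (suc k)))
    n-mono (+<+ {_} {k} i<j) = walk-⊏ g⁻ i<j (reaches-g k)

    family : PairFamily ℤ._<_
    family = record
      { pos          = p
      ; neg          = n
      ; pos-positive = λ where
          (+ zero)  → h⁺
          (+ suc k) → negative-⋆ involutive (walk-negative g⁻ k (reaches-g k))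
          -[1+ k ]  → walk-positive h⁺ (suc k) (reaches-h (suc k))
      ; neg-negative = λ where
          (+ k)     → walk-negative g⁻ k (reaches-g k)
          -[1+ k ]  → positive-⋆ (walk-positive h⁺ k (reaches-h k))
      ; pos∥neg      = λ where
          (+ zero)  → ∥-sym g∥h
          (+ suc k) → walk-∥ (reaches-g (suc k))
          -[1+ k ]  → ∥-sym (walk-∥ (reaches-h (suc k)))
      ; neg-mono     = n-mono
      }
    open PairFamily family

    chain = ℤ.<-isStrictTotalOrder

    ⊆image : ∀ {x} → x ∈ ⟨ g ⟩ → x ∈ Image (embedding chain)
    ⊆image x∈ with ⟨⟩⊆reached-∥ g∥h x∈
    ... | inj₁ (k     , _ , stop x≈) = neg∈image chain (+ k) x≈
    ... | inj₁ (k     , _ , star x≈) = pos∈image chain (+ suc k) x≈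
    ... | inj₂ (zero  , _ , stop x≈) = pos∈image chain (+ zero) x≈
    ... | inj₂ (suc k , _ , stop x≈) = pos∈image chain -[1+ k ] x≈
    ... | inj₂ (k     , _ , star x≈) = neg∈image chain -[1+ k ] x≈

  -- Allows the walk to begin at an end of the path instead of at the given generator.
  generator-shift : ∀ {g x} → Generator g → ¬ x ≈ 1# → Generator x
  generator-shift {g} {x} isGen x≉1 y with isGen x | isGen y
  ... | inj₁ x≈1 | _        = contradiction x≈1 x≉1
  ... | _        | inj₁ y≈1 = inj₁ y≈1
  ... | inj₂ x∈  | inj₂ y∈  = inj₂ (⟨⟩-trans y∈ (⟨⟩-sym x∈))

  generated⇒crownian : NonTrivial → OneGenerated → Crownian A
  generated⇒crownian (x , y , x≉y) (g , generates) = classify bottom? top?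
    where
    isGen : Generator g
    isGen z = Sum.swap (Sg⊆⟨⟩∪1 (generates z))

    g≉1 : ¬ g ≈ 1#
    g≉1 g≈1 = x≉y (≈-trans (trivial x) (≈-sym (trivial y)))
      where
      trivial : ∀ z → z ≈ 1#
      trivial z = [ id , ⟨1⟩ g≈1 ]′ (isGen z)

    Bottom Top : Set (c ⊔ ℓ₁ ⊔ ℓ₂)
    Bottom = ∃ λ x → Negative x × ¬ Partnered x
    Top    = ∃ λ x → Positive x × ¬ Partnered x

    bottom? : Dec Bottom
    bottom? = em

    top? : Dec Top
    top? = em

    negative-partnered : ¬ Bottom → ∀ {x} → Negative x → Partnered x
    negative-partnered ¬bottom {x} x⁻ =
      decidable-stable (Partnered? x) λ ¬p → ¬bottom (x , x⁻ , ¬p)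

    positive-partnered : ¬ Top → ∀ {x} → Positive x → Partnered x
    positive-partnered ¬top {x} x⁺ =
      decidable-stable (Partnered? x) λ ¬p → ¬top (x , x⁺ , ¬p)

    classify : Dec Bottom → Dec Top → Crownian A
    classify (yes (o , o⁻ , unpartnered)) _
      with decide ℓ₂ em (∃ λ n → ¬ Partnered (walk o n ⋆))
    ... | no never =
      crownian-ℕ o⁻ unpartnered (generator-shift isGen (proj₂ o⁻))
        λ k → decidable-stable (Partnered? _) λ ¬p → never (k , ¬p)
    -- Minimality of n provides the partners for all earlier steps, that is `Reaches o n`.
    ... | yes (m , ¬p) =
      let n , stops , minimal = least (λ n → ¬? (Partnered? (walk o n ⋆))) m ¬p
      in crownian-Fin o⁻ unpartnered (generator-shift isGen (proj₂ o⁻)) n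
           (λ j j<n → decidable-stable (Partnered? _) (minimal j j<n)) stops
    classify (no ¬bottom) (yes (t , t⁺ , unpartnered)) =
      crownian-ℕ∂ t⁺ unpartnered (generator-shift isGen (proj₂ t⁺))
        (λ k → partnered k (reaches k))
      where
      partnered : ∀ k → Reaches t k → Partnered (walk t k ⋆)
      partnered k r = negative-partnered ¬bottom (positive-⋆ (walk-positive t⁺ k r))

      reaches : ∀ k → Reaches t k
      reaches (suc k) j (s≤s j≤k) = partnered j (λ i i<j → reaches k i (ℕ.<-≤-trans i<j j≤k))
    classify (no ¬bottom) (no ¬top) = [ from-positive , from-negative ]′ (sign g≉1)
      where
      partnered : ∀ {x} → ¬ x ≈ 1# → Partnered x
      partnered x≉1 = [ positive-partnered ¬top , negative-partnered ¬bottom ]′ (sign x≉1)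

      from-negative : ∀ {x} → Negative x → Crownian A
      from-negative x⁻ = crownian-ℤ x⁻ (generator-shift isGen (proj₂ x⁻)) partnered

      from-positive : ∀ {x} → Positive x → Crownian A
      from-positive x⁺ = from-negative (positive-⋆ x⁺)

lemma4p20 : {c ℓ₁ ℓ₂ : Level} → ExcludedMiddle (c ⊔ ℓ₁ ⊔ ℓ₂) →
  ((A : IdempotentResiduatedChain c ℓ₁ ℓ₂) →
    let open IdempotentResiduatedChain A
        open Layers (enhancedMonoidalPreorder A) in
    ⋆-Involutive → (x : Carrier) → ¬ (x ≈ 1#) → LayerConvex ⟨ x ⟩)
  ×
  ((A : IdempotentResiduatedChain c ℓ₁ ℓ₂) →
    let open IdempotentResiduatedChain A in
    NonTrivial → (OneGenerated × ⋆-Involutive) ⇔ Crownian A)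
lemma4p20 em =
    (λ A → ClassicalChain.⟨⟩-layerConvex em A)
  , λ A nonTrivial → mk⇔
      (λ (generated , involutive) →
        ToCrown.generated⇒crownian em A involutive nonTrivial generated)
      (λ (C , φ , φ1≈1) → FromCrown.oneGenerated em A (body C) (ladder C) φ φ1≈1
                        , FromCrown.involutive em A (body C) (ladder C) φ φ1≈1)
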